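{- Let $p$ be an odd prime and let $k$ be an integer with $1\le k\le p-1$. Let $\Sigma_{p,k}=\sum_{l=1}^{p-2}\frac{B_l}{l\,k^l}$. Let $x_k\in\mathbb{Z}_p$ be the root of $X^{p-1}+(p-1)!$ with $x_k\equiv k\pmod p$. Then $\Sigma_{p,k}\equiv0\pmod p$ if and only if $(x_k)_1=0$.
   Context: $B_l$ are the Bernoulli numbers (with $B_1=-\tfrac12$). The polynomial $X^{p-1}+(p-1)!$ has, for each $k\in\{1,\dots,p-1\}$, exactly one root in $\mathbb{Z}_p$ congruent to $k$ modulo $p$. For a $p$-adic integer $x$, write $x=\sum_{j\ge0}(x)_jp^j$ with digits $(x)_j\in\{0,\dots,p-1\}$, so $(x)_1$ is the second residue in the $p$-adic expansion. -}

module Defs where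

open import Data.Nat as ℕ using (ℕ; zero; suc; _^_; _∸_)
open import Data.Nat.Combinatorics using (_C_)
open import Data.Nat.Divisibility using (_∣_)
open import Data.Fin using (Fin; toℕ)
open import Data.Integer as ℤ using (ℤ; +_)
open import Data.Rational as ℚ using (ℚ; _+_; _*_; -_; _/_; ↥_; ↧ₙ_; 0ℚ; 1ℚ)
open import Data.List using (List; []; _∷_; _++_; [_])
open import Data.Product using (_×_)
open import Relation.Nullary using (¬_)

nth : List ℚ → ℕ → ℚ
nth []       _       = 0ℚ
nth (x ∷ xs) zero    = x
nth (x ∷ xs) (suc i) = nth xs i

invℕ : ℕ → ℚ
invℕ zero    = 0ℚ
invℕ (suc n) = + 1 / suc n

fromℕ : ℕ → ℚ
fromℕ n = + n / 1

-- Σ_{j = i}^{n-1} C(n+1, j) B_j, where bs lists B_i, B_{i+1}, ...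
private
  binomSum : ℕ → ℕ → List ℚ → ℚ
  binomSum n i []       = 0ℚ
  binomSum n i (b ∷ bs) = fromℕ ((suc n) C i) * b + binomSum n (suc i) bs

-- B_n from the list [B_0, ..., B_{n-1}]:
--   B_0 = 1,   B_n = -1/(n+1) Σ_{j<n} C(n+1,j) B_j   (n ≥ 1)
nextBernoulli : ℕ → List ℚ → ℚ
nextBernoulli zero    _  = 1ℚ
nextBernoulli (suc n) bs = - (invℕ (suc (suc n)) * binomSum (suc n) 0 bs)

bernoulliList : ℕ → List ℚ
bernoulliList zero    = []
bernoulliList (suc n) = bernoulliList n ++ [ nextBernoulli n (bernoulliList n) ]

-- Bernoulli numbers, convention B_1 = -1/2
bernoulli : ℕ → ℚ
bernoulli n = nth (bernoulliList (suc n)) n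

sumBern : ℕ → ℕ → ℚ
sumBern k zero    = 0ℚ
sumBern k (suc m) = sumBern k m + bernoulli (suc m) * invℕ (suc m ℕ.* k ^ suc m)

Σpk : ℕ → ℕ → ℚ
Σpk p k = sumBern k (p ∸ 2)

-- a rational r is ≡ 0 (mod p): p-integral (p ∤ denominator of reduced form)
-- and p divides the reduced numerator
≡0modℚ : ℕ → ℚ → Set
≡0modℚ p r = (p ∣ ℤ.∣ ↥ r ∣) × ¬ (p ∣ ↧ₙ r)

-- p-adic integers as digit streams: x = Σ_j (x j) p^j
ℤₚ : ℕ → Set
ℤₚ p = ℕ → Fin p

trunc : ∀ {p} → ℤₚ p → ℕ → ℕ
trunc x zero          = 0
trunc {p} x (suc n)   = trunc x n ℕ.+ toℕ (x n) ℕ.* p ^ n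

IsRoot : (p : ℕ) → ℤₚ p → Set
IsRoot p x = ∀ n → p ^ n ∣ (trunc x n ^ (p ∸ 1) ℕ.+ (p ∸ 1) !)
  where open import Data.Nat using (_!)

-- The Bernoulli polynomial B_p(x) = Σ C(p,i) B_i x^(p-i) satisfies B_p(x+1) - B_p(x) = p x^(p-1).
-- Summing this from - k to 0 and using p | C(p,i) gives, modulo p²,
--   p k^p Σ_{p,k} ≡ k^p + p B_{p-1} k - p k,
-- and summing it from 0 to p gives Σ_{j<p} j^(p-1) ≡ p B_{p-1}. The left-hand side is also
-- ≡ (p-1)! + p, because the product of the j^(p-1) ≡ 1 (mod p) is ((p-1)!)^(p-1). Hence
-- p k Σ_{p,k} ≡ k (k^(p-1) + (p-1)!), and expanding the root x_k = k + (x_k)_1 p + … to first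
-- order turns this into k Σ_{p,k} ≡ (x_k)_1 (mod p).
-- All congruences are between rationals, modulo multiples by p-integral rationals.
module Submission where

open import Defs
open import Algebra.Bundles using (CommutativeRing)
open import Data.Fin using (toℕ)
open import Data.Fin.Properties using (toℕ<n)
open import Data.Integer as ℤ using (ℤ)
import Data.Integer.Divisibility.Signed as ℤ∣
import Data.Integer.Properties as ℤ
open import Data.List using (List; []; _∷_; _++_; [_]; length)
open import Data.List.Properties using (length-++)
open import Data.Nat as ℕ using (ℕ; zero; suc; _∸_; _≤_; _<_; _!; s≤s; s<s)
open import Data.Nat.Combinatorics using (_C_; nCn≡1; nC1≡n; nCk≡nC[n∸k]; k>n⇒nCk≡0; nCk+nC[k+1]≡[n+1]C[k+1])
import Data.Nat.Coprimality as Coprimality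
open import Data.Nat.Divisibility using (_∣_; divides; >⇒∤)
open import Data.Nat.Primality using (Prime; prime⇒nonTrivial; prime⇒irreducible; euclidsLemma)
import Data.Nat.Properties as ℕ
open import Data.Nat.Tactic.RingSolver using (solve-∀)
open import Data.Product using (_×_; _,_; proj₂)
open import Data.Rational using (ℚ; mkℚ; ↥_; ↧ₙ_; 0ℚ; 1ℚ; _+_; _*_; _-_; -_; _/_; toℚᵘ)
open import Data.Rational.Properties
open import Data.Rational.Solver using (module +-*-Solver)
open import Data.Rational.Unnormalised as ℚᵘ using (mkℚᵘ; *≡*)
import Data.Rational.Unnormalised.Properties as ℚᵘ
open import Data.Sum as Sum using (_⊎_; inj₁; inj₂)
open import Function using (_∘_; id)
open import Function.Bundles using (_⇔_; mk⇔)
open import Relation.Binary.PropositionalEquality using (_≡_; _≢_; refl; sym; trans; cong; cong₂; subst; subst₂; module ≡-Reasoning)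
open import Relation.Nullary using (¬_; contradiction)
open import Algebra.Properties.CommutativeSemiring.Exp (CommutativeRing.commutativeSemiring +-*-commutativeRing) using (^-distrib-*)
open import Algebra.Properties.Semiring.Exp (CommutativeRing.semiring +-*-commutativeRing) using (_^_; ^-homo-*)
open +-*-Solver using (solve; _:=_; _:+_; _:*_; _:-_; :-_; con)
open ≡-Reasoning

-- The polynomial is evaluated at -k rather than k because the term with B_(j+1) has coefficient p
-- C(p-1, j) / (j + 1), and C(p-1, j) ≡ (-1)^j modulo p: the signs in (-k)^(p-1-j) cancel and
-- exactly the terms of Σ remain. The obstacle is integrality. The recurrence makes B_0, ...,
-- B_(p-2) p-integral, since it divides by numbers below p, but this argument stops at B_(p-1),
-- which may have p in its denominator. So B_p is only ever cancelled between two expressions for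
-- one value, and B_(p-1) stays exact until the power sum replaces p B_(p-1). Wilson's congruence
-- (p-1)! ≡ -1 is supplied by the root itself, as k^(p-1) ≡ 1.

-- Integers and naturals inside ℚ

ι : ℤ → ℚ
ι z = z / 1

toℚᵘ-ι : ∀ z → toℚᵘ (ι z) ℚᵘ.≃ mkℚᵘ z 0
toℚᵘ-ι z = toℚᵘ-fromℚᵘ (mkℚᵘ z 0)

ι-homo-+ : ∀ a b → ι (a ℤ.+ b) ≡ ι a + ι b
ι-homo-+ a b = toℚᵘ-injective (begin′
  toℚᵘ (ι (a ℤ.+ b))             ≈⟨ toℚᵘ-ι (a ℤ.+ b) ⟩
  mkℚᵘ (a ℤ.+ b) 0               ≈⟨ *≡* (cong (ℤ._* ℤ.+ 1) (sym (cong₂ ℤ._+_ (ℤ.*-identityʳ a) (ℤ.*-identityʳ b)))) ⟩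
  mkℚᵘ a 0 ℚᵘ.+ mkℚᵘ b 0         ≈⟨ ℚᵘ.+-cong (toℚᵘ-ι a) (toℚᵘ-ι b) ⟨
  toℚᵘ (ι a) ℚᵘ.+ toℚᵘ (ι b)     ≈⟨ toℚᵘ-homo-+ (ι a) (ι b) ⟨
  toℚᵘ (ι a + ι b)               ∎′)
  where open import Relation.Binary.Reasoning.Setoid ℚᵘ.≃-setoid renaming (begin_ to begin′_; _∎ to _∎′)

ι-homo-* : ∀ a b → ι (a ℤ.* b) ≡ ι a * ι b
ι-homo-* a b = toℚᵘ-injective (begin′
  toℚᵘ (ι (a ℤ.* b))             ≈⟨ toℚᵘ-ι (a ℤ.* b) ⟩
  mkℚᵘ a 0 ℚᵘ.* mkℚᵘ b 0         ≈⟨ ℚᵘ.*-cong (toℚᵘ-ι a) (toℚᵘ-ι b) ⟨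
  toℚᵘ (ι a) ℚᵘ.* toℚᵘ (ι b)     ≈⟨ toℚᵘ-homo-* (ι a) (ι b) ⟨
  toℚᵘ (ι a * ι b)               ∎′)
  where open import Relation.Binary.Reasoning.Setoid ℚᵘ.≃-setoid renaming (begin_ to begin′_; _∎ to _∎′)

ι-injective : ∀ {a b} → ι a ≡ ι b → a ≡ b
ι-injective {a} {b} eq with ℚᵘ.≃-trans (ℚᵘ.≃-sym (toℚᵘ-ι a)) (ℚᵘ.≃-trans (toℚᵘ-cong eq) (toℚᵘ-ι b))
... | *≡* a*1≡b*1 = ℤ.*-cancelʳ-≡ a b (ℤ.+ 1) a*1≡b*1

fromℕ-homo-+ : ∀ a b → fromℕ (a ℕ.+ b) ≡ fromℕ a + fromℕ b
fromℕ-homo-+ a b = ι-homo-+ (ℤ.+ a) (ℤ.+ b)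

fromℕ-suc : ∀ a → fromℕ (suc a) ≡ 1ℚ + fromℕ a
fromℕ-suc = fromℕ-homo-+ 1

fromℕ-homo-* : ∀ a b → fromℕ (a ℕ.* b) ≡ fromℕ a * fromℕ b
fromℕ-homo-* a b = trans (cong ι (ℤ.pos-* a b)) (ι-homo-* (ℤ.+ a) (ℤ.+ b))

fromℕ-homo-^ : ∀ a n → fromℕ (a ℕ.^ n) ≡ fromℕ a ^ n
fromℕ-homo-^ a zero    = refl
fromℕ-homo-^ a (suc n) = trans (fromℕ-homo-* a (a ℕ.^ n)) (cong (fromℕ a *_) (fromℕ-homo-^ a n))

fromℕ*invℕ : ∀ n → fromℕ (suc n) * invℕ (suc n) ≡ 1ℚ
fromℕ*invℕ n = toℚᵘ-injective (begin′
  toℚᵘ (fromℕ (suc n) * invℕ (suc n))            ≈⟨ toℚᵘ-homo-* (fromℕ (suc n)) (invℕ (suc n)) ⟩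
  toℚᵘ (fromℕ (suc n)) ℚᵘ.* toℚᵘ (invℕ (suc n))  ≈⟨ ℚᵘ.*-cong (toℚᵘ-ι (ℤ.+ suc n)) (toℚᵘ-fromℚᵘ (mkℚᵘ (ℤ.+ 1) n)) ⟩
  mkℚᵘ (ℤ.+ suc n) 0 ℚᵘ.* mkℚᵘ (ℤ.+ 1) n             ≈⟨ *≡* (trans (ℤ.*-identityʳ _) (trans (ℤ.*-comm (ℤ.+ suc n) (ℤ.+ 1)) (cong (λ d → ℤ.+ 1 ℤ.* ℤ.+ suc d) (sym (ℕ.+-identityʳ n))))) ⟩
  mkℚᵘ (ℤ.+ 1) 0                                   ∎′)
  where open import Relation.Binary.Reasoning.Setoid ℚᵘ.≃-setoid renaming (begin_ to begin′_; _∎ to _∎′)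

fromℕ*-cancelˡ : ∀ n {x y} → fromℕ (suc n) * x ≡ fromℕ (suc n) * y → x ≡ y
fromℕ*-cancelˡ n {x} {y} eq = begin
  x            ≡⟨ undo x ⟩
  v * (u * x)  ≡⟨ cong (v *_) eq ⟩
  v * (u * y)  ≡⟨ undo y ⟨
  y            ∎
  where
  u v : ℚ
  u = fromℕ (suc n)
  v = invℕ (suc n)
  undo : ∀ z → z ≡ v * (u * z)
  undo z = begin
    z            ≡⟨ *-identityˡ z ⟨
    1ℚ * z       ≡⟨ cong (_* z) (fromℕ*invℕ n) ⟨
    u * v * z    ≡⟨ solve 3 (λ u v z → u :* v :* z := v :* (u :* z)) refl u v z ⟩
    v * (u * z)  ∎

-- Binomial coefficients

infix 8 _Cℚ_
_Cℚ_ : ℕ → ℕ → ℚ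
n Cℚ k = fromℕ (n C k)

pascal : ∀ n k → suc n Cℚ suc k ≡ n Cℚ k + n Cℚ suc k
pascal n k = trans (cong fromℕ (sym (nCk+nC[k+1]≡[n+1]C[k+1] n k))) (fromℕ-homo-+ (n C k) (n C suc k))

-- Induction with Pascal's rule; this is what exposes the factor p in C(p, k + 1).
absorption : ∀ n k → suc k ℕ.* (suc n C suc k) ≡ suc n ℕ.* (n C k)
absorption zero    zero    = refl
absorption zero    (suc k) = ℕ.*-zeroʳ k
absorption (suc n) zero    = trans (ℕ.*-identityˡ _) (trans (nC1≡n (suc (suc n))) (sym (ℕ.*-identityʳ _)))
absorption (suc n) (suc k) = begin
  suc (suc k) ℕ.* (suc (suc n) C suc (suc k))
    ≡⟨ cong (suc (suc k) ℕ.*_) (nCk+nC[k+1]≡[n+1]C[k+1] (suc n) (suc k)) ⟨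
  suc (suc k) ℕ.* (c ℕ.+ d)
    ≡⟨ expand k c d ⟩
  c ℕ.+ (suc k ℕ.* c ℕ.+ suc (suc k) ℕ.* d)
    ≡⟨ cong₂ (λ u v → c ℕ.+ (u ℕ.+ v)) (absorption n k) (absorption n (suc k)) ⟩
  c ℕ.+ (suc n ℕ.* (n C k) ℕ.+ suc n ℕ.* (n C suc k))
    ≡⟨ cong (c ℕ.+_) (ℕ.*-distribˡ-+ (suc n) (n C k) (n C suc k)) ⟨
  c ℕ.+ suc n ℕ.* (n C k ℕ.+ n C suc k)
    ≡⟨ cong (λ z → c ℕ.+ suc n ℕ.* z) (nCk+nC[k+1]≡[n+1]C[k+1] n k) ⟩
  suc (suc n) ℕ.* c ∎
  where
  c d : ℕ
  c = suc n C suc k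
  d = suc n C suc (suc k)
  expand : ∀ k c d → suc (suc k) ℕ.* (c ℕ.+ d) ≡ c ℕ.+ (suc k ℕ.* c ℕ.+ suc (suc k) ℕ.* d)
  expand = solve-∀

-- Finite sums, powers and products

∑ : ℕ → (ℕ → ℚ) → ℚ
∑ zero    f = 0ℚ
∑ (suc n) f = ∑ n f + f n

∑-cong : ∀ n {f g} → (∀ i → i < n → f i ≡ g i) → ∑ n f ≡ ∑ n g
∑-cong zero    eq = refl
∑-cong (suc n) eq = cong₂ _+_ (∑-cong n (λ i i<n → eq i (ℕ.m<n⇒m<1+n i<n))) (eq n ℕ.≤-refl)

∑-head : ∀ n f → ∑ (suc n) f ≡ f 0 + ∑ n (f ∘ suc)
∑-head zero    f = +-comm 0ℚ (f 0)
∑-head (suc n) f = trans (cong (_+ f (suc n)) (∑-head n f)) (+-assoc (f 0) _ _)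

∑-+ : ∀ n f g → ∑ n (λ i → f i + g i) ≡ ∑ n f + ∑ n g
∑-+ zero    f g = refl
∑-+ (suc n) f g = trans (cong (_+ (f n + g n)) (∑-+ n f g))
  (solve 4 (λ s t a b → s :+ t :+ (a :+ b) := s :+ a :+ (t :+ b)) refl (∑ n f) (∑ n g) (f n) (g n))

∑-* : ∀ n c f → ∑ n (λ i → c * f i) ≡ c * ∑ n f
∑-* zero    c f = sym (*-zeroʳ c)
∑-* (suc n) c f = trans (cong (_+ c * f n) (∑-* n c f)) (sym (*-distribˡ-+ c (∑ n f) (f n)))

neg-^-even : ∀ x h → (- x) ^ (h ℕ.* 2) ≡ x ^ (h ℕ.* 2)
neg-^-even x zero    = refl
neg-^-even x (suc h) = trans (cong (λ z → - x * (- x * z)) (neg-^-even x h))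
  (solve 2 (λ x z → :- x :* (:- x :* z) := x :* (x :* z)) refl x (x ^ (h ℕ.* 2)))

1^n≡1 : ∀ n → 1ℚ ^ n ≡ 1ℚ
1^n≡1 zero    = refl
1^n≡1 (suc n) = trans (*-identityˡ (1ℚ ^ n)) (1^n≡1 n)

∑-const : ∀ n c → ∑ n (λ _ → c) ≡ fromℕ n * c
∑-const zero    c = sym (*-zeroˡ c)
∑-const (suc n) c = begin
  ∑ n (λ _ → c) + c    ≡⟨ cong (_+ c) (∑-const n c) ⟩
  fromℕ n * c + c      ≡⟨ solve 2 (λ n c → n :* c :+ c := (con 1ℚ :+ n) :* c) refl (fromℕ n) c ⟩
  (1ℚ + fromℕ n) * c   ≡⟨ cong (_* c) (fromℕ-suc n) ⟨
  fromℕ (suc n) * c    ∎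

cancel-invℕ : ∀ a b .⦃ _ : ℕ.NonZero b ⦄ → fromℕ b * invℕ (suc a ℕ.* b) ≡ invℕ (suc a)
cancel-invℕ a b@(suc b-1) = fromℕ*-cancelˡ a (begin
  fromℕ (suc a) * (fromℕ b * invℕ (suc a ℕ.* b))  ≡⟨ *-assoc (fromℕ (suc a)) (fromℕ b) _ ⟨
  fromℕ (suc a) * fromℕ b * invℕ (suc a ℕ.* b)    ≡⟨ cong (_* invℕ (suc a ℕ.* b)) (fromℕ-homo-* (suc a) b) ⟨
  fromℕ (suc a ℕ.* b) * invℕ (suc a ℕ.* b)        ≡⟨ fromℕ*invℕ (b-1 ℕ.+ a ℕ.* b) ⟩
  1ℚ                                              ≡⟨ fromℕ*invℕ a ⟨
  fromℕ (suc a) * invℕ (suc a)                    ∎)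

-- C(n + 1, k + 1) / (n + 1), written so that p-integrality is visible when n + 1 = p.
β : ℕ → ℕ → ℚ
β n k = n Cℚ k * invℕ (suc k)

Cℚ-suc-suc : ∀ n k → suc n Cℚ suc k ≡ fromℕ (suc n) * β n k
Cℚ-suc-suc n k = fromℕ*-cancelˡ k (begin
  fromℕ (suc k) * suc n Cℚ suc k             ≡⟨ fromℕ-homo-* (suc k) (suc n C suc k) ⟨
  fromℕ (suc k ℕ.* (suc n C suc k))          ≡⟨ cong fromℕ (absorption n k) ⟩
  fromℕ (suc n ℕ.* (n C k))                  ≡⟨ fromℕ-homo-* (suc n) (n C k) ⟩
  fromℕ (suc n) * n Cℚ k                     ≡⟨ *-identityʳ _ ⟨
  fromℕ (suc n) * n Cℚ k * 1ℚ                ≡⟨ cong (fromℕ (suc n) * n Cℚ k *_) (fromℕ*invℕ k) ⟨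
  fromℕ (suc n) * n Cℚ k * (fromℕ (suc k) * invℕ (suc k))
    ≡⟨ solve 4 (λ n c k i → n :* c :* (k :* i) := k :* (n :* (c :* i))) refl (fromℕ (suc n)) (n Cℚ k) (fromℕ (suc k)) (invℕ (suc k)) ⟩
  fromℕ (suc k) * (fromℕ (suc n) * β n k)    ∎)

even-or-odd : ∀ n → 2 ∣ n ⊎ 2 ∣ suc n
even-or-odd zero    = inj₁ (divides 0 refl)
even-or-odd (suc n) with even-or-odd n
... | inj₁ (divides q n≡2q) = inj₂ (divides (suc q) (cong (λ l → suc (suc l)) n≡2q))
... | inj₂ 2∣1+n            = inj₁ 2∣1+n

∏ : ℕ → (ℕ → ℚ) → ℚ
∏ zero    f = 1ℚ
∏ (suc n) f = ∏ n f * f n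

∏-const : ∀ n c → ∏ n (λ _ → c) ≡ c ^ n
∏-const zero    c = refl
∏-const (suc n) c = trans (cong (_* c) (∏-const n c)) (*-comm (c ^ n) c)

ι-homo-neg : ∀ a → ι (ℤ.- a) ≡ - ι a
ι-homo-neg a = begin
  ι (ℤ.- a)                        ≡⟨ solve 2 (λ x y → y := :- x :+ (x :+ y)) refl (ι a) (ι (ℤ.- a)) ⟩
  - ι a + (ι a + ι (ℤ.- a))        ≡⟨ cong (λ z → - ι a + z) (ι-homo-+ a (ℤ.- a)) ⟨
  - ι a + ι (a ℤ.+ ℤ.- a)          ≡⟨ cong (λ z → - ι a + ι z) (ℤ.+-inverseʳ a) ⟩
  - ι a + 0ℚ                       ≡⟨ +-identityʳ (- ι a) ⟩
  - ι a                            ∎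

*-↧ : ∀ r → r * fromℕ (↧ₙ r) ≡ ι (↥ r)
*-↧ r@(mkℚ n d-1 _) = toℚᵘ-injective (begin′
  toℚᵘ (r * fromℕ d)              ≈⟨ toℚᵘ-homo-* r (fromℕ d) ⟩
  toℚᵘ r ℚᵘ.* toℚᵘ (fromℕ d)      ≈⟨ ℚᵘ.*-congˡ {toℚᵘ r} (toℚᵘ-ι (ℤ.+ d)) ⟩
  toℚᵘ r ℚᵘ.* mkℚᵘ (ℤ.+ d) 0      ≈⟨ *≡* (trans (ℤ.*-assoc n (ℤ.+ d) (ℤ.+ 1)) (cong (n ℤ.*_) (sym (ℤ.pos-* d 1)))) ⟩
  mkℚᵘ n 0                        ≈⟨ toℚᵘ-ι n ⟨
  toℚᵘ (ι n)                      ∎′)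
  where
  d : ℕ
  d = suc d-1
  open import Relation.Binary.Reasoning.Setoid ℚᵘ.≃-setoid renaming (begin_ to begin′_; _∎ to _∎′)

-- The Bernoulli recurrence as a finite sum

binom : ℕ → ℕ → List ℚ → ℚ
binom n i bs = ∑ (length bs) (λ j → suc n Cℚ (i ℕ.+ j) * nth bs j)

binom-∷ : ∀ n i b bs → binom n i (b ∷ bs) ≡ suc n Cℚ i * b + binom n (suc i) bs
binom-∷ n i b bs = trans (∑-head (length bs) _)
  (cong₂ _+_ (cong (λ j → suc n Cℚ j * b) (ℕ.+-identityʳ i))
    (∑-cong (length bs) (λ j _ → cong (λ l → suc n Cℚ l * nth bs j) (ℕ.+-suc i j))))

-- The summation inside nextBernoulli is private to Defs: once `with` has turned its
-- arguments into variables, unification finds it. The parameter f stands for binom,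
-- which would not survive that abstraction.
mutual
  privateSum : ℕ → ℕ → List ℚ → ℚ
  privateSum = _

  nextBernoulli-privateSum : (f : ℕ → ℕ → List ℚ → ℚ) → (∀ n i bs → privateSum n i bs ≡ f n i bs) →
    ∀ n bs → nextBernoulli (suc n) bs ≡ - (invℕ (suc (suc n)) * f (suc n) 0 bs)
  nextBernoulli-privateSum f eq n bs with invℕ (suc (suc n))
  ... | v with suc n | 0
  ... | m | i = cong (λ s → - (v * s)) (eq m i bs)

-- Unification has solved `privateSum` to the actual recursive summation, so both of its clauses
-- reduce and induction on the list applies.
privateSum-binom : ∀ n i bs → privateSum n i bs ≡ binom n i bs
privateSum-binom n i []       = refl
privateSum-binom n i (b ∷ bs) = trans (cong (λ s → suc n Cℚ i * b + s) (privateSum-binom n (suc i) bs))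
  (sym (binom-∷ n i b bs))

nextBernoulli-suc : ∀ n bs → nextBernoulli (suc n) bs ≡ - (invℕ (suc (suc n)) * binom (suc n) 0 bs)
nextBernoulli-suc = nextBernoulli-privateSum binom privateSum-binom

nth-++ˡ : ∀ xs ys {i} → i < length xs → nth (xs ++ ys) i ≡ nth xs i
nth-++ˡ (x ∷ xs) ys {zero}  _         = refl
nth-++ˡ (x ∷ xs) ys {suc i} (s<s i<n) = nth-++ˡ xs ys i<n

nth-length : ∀ xs y → nth (xs ++ [ y ]) (length xs) ≡ y
nth-length []       y = refl
nth-length (x ∷ xs) y = nth-length xs y

length-bernoulliList : ∀ n → length (bernoulliList n) ≡ n
length-bernoulliList zero    = refl
length-bernoulliList (suc n) = trans (length-++ (bernoulliList n))
  (trans (ℕ.+-comm _ 1) (cong suc (length-bernoulliList n)))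

bernoulli-next : ∀ n → bernoulli n ≡ nextBernoulli n (bernoulliList n)
bernoulli-next n = subst (λ l → nth (bernoulliList (suc n)) l ≡ nextBernoulli n (bernoulliList n))
  (length-bernoulliList n) (nth-length (bernoulliList n) _)

nth-bernoulliList : ∀ n {i} → i < n → nth (bernoulliList n) i ≡ bernoulli i
nth-bernoulliList (suc n) {i} i<1+n with ℕ.m≤n⇒m<n∨m≡n (ℕ.s≤s⁻¹ i<1+n)
... | inj₁ i<n  = trans (nth-++ˡ (bernoulliList n) _ (subst (i <_) (sym (length-bernoulliList n)) i<n)) (nth-bernoulliList n i<n)
... | inj₂ refl = refl

bernoulli-suc : ∀ n → bernoulli (suc n) ≡ - (invℕ (suc (suc n)) * ∑ (suc n) (λ j → suc (suc n) Cℚ j * bernoulli j))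
bernoulli-suc n = begin
  bernoulli (suc n)
    ≡⟨ bernoulli-next (suc n) ⟩
  nextBernoulli (suc n) (bernoulliList (suc n))
    ≡⟨ nextBernoulli-suc n (bernoulliList (suc n)) ⟩
  - (invℕ (suc (suc n)) * binom (suc n) 0 (bernoulliList (suc n)))
    ≡⟨ cong (λ l → - (invℕ (suc (suc n)) * ∑ l (λ j → suc (suc n) Cℚ j * nth (bernoulliList (suc n)) j))) (length-bernoulliList (suc n)) ⟩
  - (invℕ (suc (suc n)) * ∑ (suc n) (λ j → suc (suc n) Cℚ j * nth (bernoulliList (suc n)) j))
    ≡⟨ cong (λ s → - (invℕ (suc (suc n)) * s)) (∑-cong (suc n) (λ j j<1+n → cong (suc (suc n) Cℚ j *_) (nth-bernoulliList (suc n) j<1+n))) ⟩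
  - (invℕ (suc (suc n)) * ∑ (suc n) (λ j → suc (suc n) Cℚ j * bernoulli j)) ∎

nC[n∸1]≡n : ∀ n → suc n C n ≡ suc n
nC[n∸1]≡n n = trans (nCk≡nC[n∸k] (ℕ.n≤1+n n)) (trans (cong (suc n C_) (ℕ.m+n∸n≡m 1 n)) (nC1≡n (suc n)))

-- The functional t^i ↦ `δ i` is the derivative at 0; it measures how far the Bernoulli functional
-- is from being invariant under t ↦ t + 1.
δ : ℕ → ℚ
δ 1 = 1ℚ
δ _ = 0ℚ

-- For m ≥ 2 the recurrence defining B_(m-1) says that the terms with i < m sum to zero. The case m
-- = 1 is the exception that `δ` records.
∑-bernoulli : ∀ m → ∑ (suc m) (λ i → m Cℚ i * bernoulli i) ≡ bernoulli m + δ m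
∑-bernoulli 0 = refl
∑-bernoulli 1 = refl
∑-bernoulli (suc (suc n)) = begin
  s + suc (suc n) Cℚ suc n * b + suc (suc n) Cℚ suc (suc n) * b′
    ≡⟨ cong₂ (λ c d → s + fromℕ c * b + fromℕ d * b′) (nC[n∸1]≡n (suc n)) (nCn≡1 (suc (suc n))) ⟩
  s + u * b + 1ℚ * b′
    ≡⟨ cong (λ z → s + u * z + 1ℚ * b′) (bernoulli-suc n) ⟩
  s + u * - (v * s) + 1ℚ * b′
    ≡⟨ solve 4 (λ s u v b′ → s :+ u :* :- (v :* s) :+ con 1ℚ :* b′ := s :* (con 1ℚ :- u :* v) :+ b′) refl s u v b′ ⟩
  s * (1ℚ - u * v) + b′
    ≡⟨ cong (λ z → s * (1ℚ - z) + b′) (fromℕ*invℕ (suc n)) ⟩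
  s * 0ℚ + b′
    ≡⟨ solve 2 (λ s b′ → s :* con 0ℚ :+ b′ := b′ :+ con 0ℚ) refl s b′ ⟩
  b′ + 0ℚ ∎
  where
  s u v b b′ : ℚ
  s  = ∑ (suc n) (λ i → suc (suc n) Cℚ i * bernoulli i)
  u  = fromℕ (suc (suc n))
  v  = invℕ (suc (suc n))
  b  = bernoulli (suc n)
  b′ = bernoulli (suc (suc n))

-- Umbral evaluation and translation

-- Umbrally, T x b m is the value at (t + x)^m of the linear functional t^i ↦ b i.
T : ℚ → (ℕ → ℚ) → ℕ → ℚ
T x b zero    = b 0
T x b (suc m) = T x (b ∘ suc) m + x * T x b m

T-cong : ∀ x {b c} → (∀ i → b i ≡ c i) → ∀ m → T x b m ≡ T x c m
T-cong x eq zero    = eq 0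
T-cong x eq (suc m) = cong₂ (λ s t → s + x * t) (T-cong x (eq ∘ suc) m) (T-cong x eq m)

T-linear : ∀ x a b c m → T x (λ i → b i + a * c i) m ≡ T x b m + a * T x c m
T-linear x a b c zero    = refl
T-linear x a b c (suc m) = trans
  (cong₂ (λ s t → s + x * t) (T-linear x a (b ∘ suc) (c ∘ suc) m) (T-linear x a b c m))
  (solve 6 (λ x a s t u v → s :+ a :* t :+ x :* (u :+ a :* v) := s :+ x :* u :+ a :* (t :+ x :* v)) refl
    x a (T x (b ∘ suc) m) (T x (c ∘ suc) m) (T x b m) (T x c m))

-- (t + x + y)^m expanded in two stages: `T x b` is the moment sequence of the functional after the
-- shift t ↦ t + x.
T-T : ∀ x y b m → T y (T x b) m ≡ T (x + y) b m
T-T x y b zero    = refl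
T-T x y b (suc m) = begin
  T y (λ i → T x (b ∘ suc) i + x * T x b i) m + y * T y (T x b) m
    ≡⟨ cong (_+ y * T y (T x b) m) (T-linear y x (T x (b ∘ suc)) (T x b) m) ⟩
  T y (T x (b ∘ suc)) m + x * T y (T x b) m + y * T y (T x b) m
    ≡⟨ cong₂ (λ s t → s + x * t + y * t) (T-T x y (b ∘ suc) m) (T-T x y b m) ⟩
  T (x + y) (b ∘ suc) m + x * T (x + y) b m + y * T (x + y) b m
    ≡⟨ solve 4 (λ x y s t → s :+ x :* t :+ y :* t := s :+ (x :+ y) :* t) refl x y (T (x + y) (b ∘ suc) m) (T (x + y) b m) ⟩
  T (x + y) (b ∘ suc) m + (x + y) * T (x + y) b m ∎

T-0 : ∀ b m → T 0ℚ b m ≡ b m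
T-0 b zero    = refl
T-0 b (suc m) = begin
  T 0ℚ (b ∘ suc) m + 0ℚ * T 0ℚ b m  ≡⟨ cong₂ _+_ (T-0 (b ∘ suc) m) (*-zeroˡ (T 0ℚ b m)) ⟩
  b (suc m) + 0ℚ                    ≡⟨ +-identityʳ _ ⟩
  b (suc m)                         ∎

T-const-0 : ∀ x m → T x (λ _ → 0ℚ) m ≡ 0ℚ
T-const-0 x zero    = refl
T-const-0 x (suc m) = trans (cong₂ (λ s t → s + x * t) (T-const-0 x m) (T-const-0 x m))
  (trans (+-identityˡ (x * 0ℚ)) (*-zeroʳ x))

T-^ : ∀ x y m → T x (y ^_) m ≡ (y + x) ^ m
T-^ x y zero    = refl
T-^ x y (suc m) = begin
  T x (λ i → y * y ^ i) m + x * T x (y ^_) m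
    ≡⟨ cong (_+ x * T x (y ^_) m) (T-cong x (λ i → sym (+-identityˡ (y * y ^ i))) m) ⟩
  T x (λ i → 0ℚ + y * y ^ i) m + x * T x (y ^_) m
    ≡⟨ cong (_+ x * T x (y ^_) m) (T-linear x y (λ _ → 0ℚ) (y ^_) m) ⟩
  T x (λ _ → 0ℚ) m + y * T x (y ^_) m + x * T x (y ^_) m
    ≡⟨ cong₂ (λ z t → z + y * t + x * t) (T-const-0 x m) (T-^ x y m) ⟩
  0ℚ + y * (y + x) ^ m + x * (y + x) ^ m
    ≡⟨ solve 3 (λ x y z → con 0ℚ :+ y :* z :+ x :* z := (y :+ x) :* z) refl x y ((y + x) ^ m) ⟩
  (y + x) * (y + x) ^ m ∎

T-δ : ∀ x m → T x δ (suc m) ≡ fromℕ (suc m) * x ^ m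
T-δ x m = begin
  T x (δ ∘ suc) m + x * T x δ m  ≡⟨ cong (_+ x * T x δ m) (T-δ∘suc m) ⟩
  x ^ m + x * T x δ m            ≡⟨ rest m ⟩
  fromℕ (suc m) * x ^ m          ∎
  where
  T-δ∘suc : ∀ m → T x (δ ∘ suc) m ≡ x ^ m
  T-δ∘suc zero    = refl
  T-δ∘suc (suc m) = trans (cong₂ (λ s t → s + x * t) (T-const-0 x m) (T-δ∘suc m)) (+-identityˡ _)
  rest : ∀ m → x ^ m + x * T x δ m ≡ fromℕ (suc m) * x ^ m
  rest zero    = solve 1 (λ x → con 1ℚ :+ x :* con 0ℚ := con 1ℚ :* con 1ℚ) refl x
  rest (suc m) = begin
    x * x ^ m + x * T x δ (suc m)                  ≡⟨ cong (λ z → x * x ^ m + x * z) (T-δ x m) ⟩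
    x * x ^ m + x * (fromℕ (suc m) * x ^ m)        ≡⟨ solve 3 (λ x y n → x :* y :+ x :* (n :* y) := (con 1ℚ :+ n) :* (x :* y)) refl x (x ^ m) (fromℕ (suc m)) ⟩
    (1ℚ + fromℕ (suc m)) * (x * x ^ m)             ≡⟨ cong (_* (x * x ^ m)) (fromℕ-suc (suc m)) ⟨
    fromℕ (suc (suc m)) * (x * x ^ m)              ∎

T-∑ : ∀ x b m → T x b m ≡ ∑ (suc m) (λ i → m Cℚ i * (b i * x ^ (m ∸ i)))
T-∑ x b zero    = solve 1 (λ b → b := con 0ℚ :+ con 1ℚ :* (b :* con 1ℚ)) refl (b 0)
T-∑ x b (suc m) = begin
  T x (b ∘ suc) m + x * T x b m
    ≡⟨ cong₂ (λ s t → s + x * t) (T-∑ x (b ∘ suc) m) (trans (T-∑ x b m) (∑-head m _)) ⟩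
  ∑ (suc m) f + x * (1ℚ * (b 0 * x ^ m) + ∑ m (λ i → m Cℚ suc i * (b (suc i) * x ^ (m ∸ suc i))))
    ≡⟨ solve 5 (λ s x b y t → s :+ x :* (con 1ℚ :* (b :* y) :+ t) := con 1ℚ :* (b :* (x :* y)) :+ (s :+ x :* t)) refl
         (∑ (suc m) f) x (b 0) (x ^ m) (∑ m (λ i → m Cℚ suc i * (b (suc i) * x ^ (m ∸ suc i)))) ⟩
  1ℚ * (b 0 * x ^ suc m) + (∑ (suc m) f + x * ∑ m (λ i → m Cℚ suc i * (b (suc i) * x ^ (m ∸ suc i))))
    ≡⟨ cong (λ z → 1ℚ * (b 0 * x ^ suc m) + (∑ (suc m) f + z)) shifted ⟩
  1ℚ * (b 0 * x ^ suc m) + (∑ (suc m) f + ∑ (suc m) g)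
    ≡⟨ cong (1ℚ * (b 0 * x ^ suc m) +_) (∑-+ (suc m) f g) ⟨
  1ℚ * (b 0 * x ^ suc m) + ∑ (suc m) (λ i → f i + g i)
    ≡⟨ cong (1ℚ * (b 0 * x ^ suc m) +_) (∑-cong (suc m) (λ i _ → trans (sym (*-distribʳ-+ (b (suc i) * x ^ (m ∸ i)) (m Cℚ i) (m Cℚ suc i)))
         (cong (_* (b (suc i) * x ^ (m ∸ i))) (sym (pascal m i))))) ⟩
  1ℚ * (b 0 * x ^ suc m) + ∑ (suc m) (λ i → suc m Cℚ suc i * (b (suc i) * x ^ (m ∸ i)))
    ≡⟨ ∑-head (suc m) _ ⟨
  ∑ (suc (suc m)) (λ i → suc m Cℚ i * (b i * x ^ (suc m ∸ i))) ∎
  where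
  f g : ℕ → ℚ
  f i = m Cℚ i * (b (suc i) * x ^ (m ∸ i))
  g i = m Cℚ suc i * (b (suc i) * x ^ (m ∸ i))
  -- The sum can be extended by one term because C(m, m + 1) = 0.
  shifted : x * ∑ m (λ i → m Cℚ suc i * (b (suc i) * x ^ (m ∸ suc i))) ≡ ∑ (suc m) g
  shifted = begin
    x * ∑ m (λ i → m Cℚ suc i * (b (suc i) * x ^ (m ∸ suc i)))
      ≡⟨ ∑-* m x _ ⟨
    ∑ m (λ i → x * (m Cℚ suc i * (b (suc i) * x ^ (m ∸ suc i))))
      ≡⟨ ∑-cong m (λ i i<m → trans
           (solve 4 (λ x c b y → x :* (c :* (b :* y)) := c :* (b :* (x :* y))) refl x (m Cℚ suc i) (b (suc i)) (x ^ (m ∸ suc i)))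
           (cong (λ l → m Cℚ suc i * (b (suc i) * x ^ l)) (sym (ℕ.+-∸-assoc 1 i<m)))) ⟩
    ∑ m g
      ≡⟨ +-identityʳ (∑ m g) ⟨
    ∑ m g + 0ℚ
      ≡⟨ cong (∑ m g +_) (trans (cong (_* (b (suc m) * x ^ (m ∸ m))) (cong fromℕ (k>n⇒nCk≡0 (ℕ.n<1+n m)))) (*-zeroˡ (b (suc m) * x ^ (m ∸ m)))) ⟨
    ∑ m g + g m ∎

-- Bernoulli polynomials and their difference equation

T-1-bernoulli : ∀ m → T 1ℚ bernoulli m ≡ bernoulli m + δ m
T-1-bernoulli m = begin
  T 1ℚ bernoulli m                                        ≡⟨ T-∑ 1ℚ bernoulli m ⟩
  ∑ (suc m) (λ i → m Cℚ i * (bernoulli i * 1ℚ ^ (m ∸ i)))  ≡⟨ ∑-cong (suc m) (λ i _ → cong (m Cℚ i *_) (trans (cong (bernoulli i *_) (1^n≡1 (m ∸ i))) (*-identityʳ _))) ⟩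
  ∑ (suc m) (λ i → m Cℚ i * bernoulli i)                   ≡⟨ ∑-bernoulli m ⟩
  bernoulli m + δ m                                       ∎

-- `T x bernoulli m` is the Bernoulli polynomial B_m(x). The shift by 1 adds `δ` to the moments, and
-- the further shift by x turns `δ` into (m + 1) x^m.
T-bernoulli-suc : ∀ x m → T (1ℚ + x) bernoulli (suc m) ≡ T x bernoulli (suc m) + fromℕ (suc m) * x ^ m
T-bernoulli-suc x m = begin
  T (1ℚ + x) bernoulli (suc m)
    ≡⟨ T-T 1ℚ x bernoulli (suc m) ⟨
  T x (T 1ℚ bernoulli) (suc m)
    ≡⟨ T-cong x (λ i → trans (T-1-bernoulli i) (cong (bernoulli i +_) (sym (*-identityˡ (δ i))))) (suc m) ⟩
  T x (λ i → bernoulli i + 1ℚ * δ i) (suc m)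
    ≡⟨ T-linear x 1ℚ bernoulli δ (suc m) ⟩
  T x bernoulli (suc m) + 1ℚ * T x δ (suc m)
    ≡⟨ cong (T x bernoulli (suc m) +_) (trans (*-identityˡ _) (T-δ x m)) ⟩
  T x bernoulli (suc m) + fromℕ (suc m) * x ^ m ∎

-- Only the two end terms of the binomial expansion lack the factor n + 1. With n + 1 = p this
-- serves both Fermat's congruence and the Bernoulli polynomial.
T-β : ∀ x b n → T x b (suc n) ≡
  b (suc n) + fromℕ (suc n) * ∑ n (λ j → β n j * (b (suc j) * x ^ (n ∸ j))) + b 0 * x ^ suc n
T-β x b n = begin
  T x b (suc n)
    ≡⟨ trans (T-∑ x b (suc n)) (∑-head (suc n) _) ⟩
  1ℚ * (b 0 * x ^ suc n) + (∑ n (λ j → suc n Cℚ suc j * f j) + suc n Cℚ suc n * f n)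
    ≡⟨ cong₂ (λ s t → 1ℚ * (b 0 * x ^ suc n) + (s + t)) middle last ⟩
  1ℚ * (b 0 * x ^ suc n) + (fromℕ (suc n) * ∑ n (λ j → β n j * f j) + b (suc n))
    ≡⟨ solve 3 (λ u s t → con 1ℚ :* u :+ (s :+ t) := t :+ s :+ u) refl (b 0 * x ^ suc n) _ (b (suc n)) ⟩
  b (suc n) + fromℕ (suc n) * ∑ n (λ j → β n j * f j) + b 0 * x ^ suc n ∎
  where
  f : ℕ → ℚ
  f j = b (suc j) * x ^ (n ∸ j)
  middle : ∑ n (λ j → suc n Cℚ suc j * f j) ≡ fromℕ (suc n) * ∑ n (λ j → β n j * f j)
  middle = trans (∑-cong n (λ j _ → trans (cong (_* f j) (Cℚ-suc-suc n j)) (*-assoc (fromℕ (suc n)) (β n j) (f j))))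
    (∑-* n (fromℕ (suc n)) (λ j → β n j * f j))
  last : suc n Cℚ suc n * f n ≡ b (suc n)
  last = begin
    suc n Cℚ suc n * f n                   ≡⟨ cong₂ (λ c e → fromℕ c * (b (suc n) * x ^ e)) (nCn≡1 (suc n)) (ℕ.n∸n≡0 n) ⟩
    1ℚ * (b (suc n) * 1ℚ)                  ≡⟨ trans (*-identityˡ _) (*-identityʳ (b (suc n))) ⟩
    b (suc n)                              ∎

-- For m + 2 = p prime and p-integral x, every term of the remaining sum is p-integral; the term in
-- B_(p-1), which may fail to be, is set apart.
T-bernoulli-β : ∀ x m → T x bernoulli (suc (suc m)) ≡
  bernoulli (suc (suc m))
    + fromℕ (suc (suc m)) * (∑ m (λ j → β (suc m) j * (bernoulli (suc j) * x ^ (suc m ∸ j))) + bernoulli (suc m) * x)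
    + x ^ suc (suc m)
T-bernoulli-β x m = trans (T-β x bernoulli (suc m))
  (cong₂ (λ s t → bernoulli (suc (suc m)) + fromℕ (suc (suc m)) * (∑ m (λ j → β (suc m) j * (bernoulli (suc j) * x ^ (suc m ∸ j))) + s) + t)
    (begin
      β (suc m) m * (bernoulli (suc m) * x ^ (suc m ∸ m))
        ≡⟨ cong₂ (λ c e → fromℕ c * invℕ (suc m) * (bernoulli (suc m) * x ^ e)) (nC[n∸1]≡n m) (ℕ.m+n∸n≡m 1 m) ⟩
      fromℕ (suc m) * invℕ (suc m) * (bernoulli (suc m) * (x * 1ℚ))
        ≡⟨ cong₂ (λ u y → u * (bernoulli (suc m) * y)) (fromℕ*invℕ m) (*-identityʳ x) ⟩
      1ℚ * (bernoulli (suc m) * x)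
        ≡⟨ *-identityˡ _ ⟩
      bernoulli (suc m) * x ∎)
    (*-identityˡ (x ^ suc (suc m))))

T-bernoulli-fromℕ : ∀ n l → T (fromℕ l) bernoulli (suc n) ≡ bernoulli (suc n) + fromℕ (suc n) * ∑ l (λ j → fromℕ j ^ n)
T-bernoulli-fromℕ n zero    = trans (T-0 bernoulli (suc n))
  (solve 2 (λ b p → b := b :+ p :* con 0ℚ) refl (bernoulli (suc n)) (fromℕ (suc n)))
T-bernoulli-fromℕ n (suc l) = begin
  T (fromℕ (suc l)) bernoulli (suc n)                         ≡⟨ cong (λ x → T x bernoulli (suc n)) (fromℕ-suc l) ⟩
  T (1ℚ + fromℕ l) bernoulli (suc n)                          ≡⟨ T-bernoulli-suc (fromℕ l) n ⟩
  T (fromℕ l) bernoulli (suc n) + fromℕ (suc n) * fromℕ l ^ n ≡⟨ cong (_+ fromℕ (suc n) * fromℕ l ^ n) (T-bernoulli-fromℕ n l) ⟩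
  b + p * s + p * fromℕ l ^ n                                 ≡⟨ solve 4 (λ b p s t → b :+ p :* s :+ p :* t := b :+ p :* (s :+ t)) refl b p s (fromℕ l ^ n) ⟩
  b + p * (s + fromℕ l ^ n)                                   ∎
  where
  b p s : ℚ
  b = bernoulli (suc n)
  p = fromℕ (suc n)
  s = ∑ l (λ j → fromℕ j ^ n)

-- The difference equation is followed from 0 down to -l; evenness of the exponent turns the powers
-- of negative numbers into those of 1, ..., l.
T-bernoulli-neg : ∀ n l → (∀ x → (- x) ^ n ≡ x ^ n) →
  T (- fromℕ l) bernoulli (suc n) ≡ bernoulli (suc n) - fromℕ (suc n) * ∑ l (λ j → fromℕ (suc j) ^ n)
T-bernoulli-neg n zero    even = trans (T-0 bernoulli (suc n))
  (solve 2 (λ b p → b := b :- p :* con 0ℚ) refl (bernoulli (suc n)) (fromℕ (suc n)))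
T-bernoulli-neg n (suc l) even = begin
  t                                     ≡⟨ solve 3 (λ t p y → t := t :+ p :* y :- p :* y) refl t p (x ^ n) ⟩
  t + p * x ^ n - p * x ^ n             ≡⟨ cong₂ (λ u y → u - p * y) (sym (T-bernoulli-suc x n)) (even (fromℕ (suc l))) ⟩
  T (1ℚ + x) bernoulli (suc n) - p * y  ≡⟨ cong (λ z → T z bernoulli (suc n) - p * y) 1+x≡-l ⟩
  T (- fromℕ l) bernoulli (suc n) - p * y ≡⟨ cong (_- p * y) (T-bernoulli-neg n l even) ⟩
  b - p * s - p * y                     ≡⟨ solve 4 (λ b p s y → b :- p :* s :- p :* y := b :- p :* (s :+ y)) refl b p s y ⟩
  b - p * (s + y)                       ∎
  where
  b p s x y t : ℚ
  b = bernoulli (suc n)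
  p = fromℕ (suc n)
  s = ∑ l (λ j → fromℕ (suc j) ^ n)
  x = - fromℕ (suc l)
  y = fromℕ (suc l) ^ n
  t = T x bernoulli (suc n)
  1+x≡-l : 1ℚ + x ≡ - fromℕ l
  1+x≡-l = trans (cong (λ z → 1ℚ + - z) (fromℕ-suc l)) (solve 1 (λ l → con 1ℚ :+ :- (con 1ℚ :+ l) := :- l) refl (fromℕ l))

-- Rationals integral at p, and congruences between them

module Local (p : ℕ) (p-prime : Prime p) where

  ∤-* : ∀ {d e} → ¬ p ∣ d → ¬ p ∣ e → ¬ p ∣ d ℕ.* e
  ∤-* {d} {e} p∤d p∤e p∣de with euclidsLemma d e p-prime p∣de
  ... | inj₁ p∣d = p∤d p∣d
  ... | inj₂ p∣e = p∤e p∣e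

  ∤1 : ¬ p ∣ 1
  ∤1 = >⇒∤ (ℕ.nonTrivial⇒n>1 p ⦃ prime⇒nonTrivial p-prime ⦄)

  ∤-< : ∀ {d} → suc d < p → ¬ p ∣ suc d
  ∤-< = >⇒∤

  record Integral (r : ℚ) : Set where
    constructor integral
    field
      den       : ℕ
      num       : ℤ
      p∤den     : ¬ p ∣ den
      r*den≡num : r * fromℕ den ≡ ι num

  integral-ι : ∀ z → Integral (ι z)
  integral-ι z = integral 1 z ∤1 (*-identityʳ (ι z))

  integral-fromℕ : ∀ n → Integral (fromℕ n)
  integral-fromℕ n = integral-ι (ℤ.+ n)

  integral-invℕ : ∀ d → ¬ p ∣ d → Integral (invℕ d)
  integral-invℕ zero    p∤0 = integral-fromℕ 0
  integral-invℕ (suc d) p∤d = integral (suc d) (ℤ.+ 1) p∤d (trans (*-comm (invℕ (suc d)) (fromℕ (suc d))) (fromℕ*invℕ d))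

  integral-+ : ∀ {r s} → Integral r → Integral s → Integral (r + s)
  integral-+ {r} {s} (integral d a p∤d rd≡a) (integral e b p∤e se≡b) =
    integral (d ℕ.* e) (a ℤ.* ℤ.+ e ℤ.+ b ℤ.* ℤ.+ d) (∤-* p∤d p∤e) (begin
      (r + s) * fromℕ (d ℕ.* e)
        ≡⟨ cong ((r + s) *_) (fromℕ-homo-* d e) ⟩
      (r + s) * (fromℕ d * fromℕ e)
        ≡⟨ solve 4 (λ r s d e → (r :+ s) :* (d :* e) := r :* d :* e :+ s :* e :* d) refl r s (fromℕ d) (fromℕ e) ⟩
      r * fromℕ d * fromℕ e + s * fromℕ e * fromℕ d
        ≡⟨ cong₂ (λ x y → x * fromℕ e + y * fromℕ d) rd≡a se≡b ⟩
      ι a * fromℕ e + ι b * fromℕ d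
        ≡⟨ cong₂ _+_ (ι-homo-* a (ℤ.+ e)) (ι-homo-* b (ℤ.+ d)) ⟨
      ι (a ℤ.* ℤ.+ e) + ι (b ℤ.* ℤ.+ d)
        ≡⟨ ι-homo-+ (a ℤ.* ℤ.+ e) (b ℤ.* ℤ.+ d) ⟨
      ι (a ℤ.* ℤ.+ e ℤ.+ b ℤ.* ℤ.+ d) ∎)

  integral-* : ∀ {r s} → Integral r → Integral s → Integral (r * s)
  integral-* {r} {s} (integral d a p∤d rd≡a) (integral e b p∤e se≡b) =
    integral (d ℕ.* e) (a ℤ.* b) (∤-* p∤d p∤e) (begin
      r * s * fromℕ (d ℕ.* e)
        ≡⟨ cong (r * s *_) (fromℕ-homo-* d e) ⟩
      r * s * (fromℕ d * fromℕ e)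
        ≡⟨ solve 4 (λ r s d e → r :* s :* (d :* e) := r :* d :* (s :* e)) refl r s (fromℕ d) (fromℕ e) ⟩
      r * fromℕ d * (s * fromℕ e)
        ≡⟨ cong₂ _*_ rd≡a se≡b ⟩
      ι a * ι b
        ≡⟨ ι-homo-* a b ⟨
      ι (a ℤ.* b) ∎)

  integral-neg : ∀ {r} → Integral r → Integral (- r)
  integral-neg {r} (integral d a p∤d rd≡a) = integral d (ℤ.- a) p∤d (begin
    - r * fromℕ d    ≡⟨ neg-distribˡ-* r (fromℕ d) ⟨
    - (r * fromℕ d)  ≡⟨ cong -_ rd≡a ⟩
    - ι a            ≡⟨ ι-homo-neg a ⟨
    ι (ℤ.- a)        ∎)

  integral-^ : ∀ {r} → Integral r → ∀ n → Integral (r ^ n)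
  integral-^ int zero    = integral-fromℕ 1
  integral-^ int (suc n) = integral-* int (integral-^ int n)

  integral-∑ : ∀ n {f} → (∀ i → i < n → Integral (f i)) → Integral (∑ n f)
  integral-∑ zero    int = integral-fromℕ 0
  integral-∑ (suc n) int = integral-+ (integral-∑ n (λ i i<n → int i (ℕ.m<n⇒m<1+n i<n))) (int n ℕ.≤-refl)

  infix 4 _≈_[_]
  -- Only the quotient has to be p-integral: `x` and `y` may have `p` in their denominators, which
  -- lets B_(p-1) appear in them.
  record _≈_[_] (x y m : ℚ) : Set where
    constructor congruent
    field
      {quotient}        : ℚ
      integral-quotient : Integral quotient
      x≡y+m*quotient    : x ≡ y + m * quotient

  ≡⇒≈ : ∀ {x y m} → x ≡ y → x ≈ y [ m ]
  ≡⇒≈ {x} {y} {m} x≡y = congruent (integral-fromℕ 0)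
    (trans x≡y (solve 2 (λ y m → y := y :+ m :* con 0ℚ) refl y m))

  ≈-refl : ∀ {x m} → x ≈ x [ m ]
  ≈-refl = ≡⇒≈ refl

  ≈-sym : ∀ {x y m} → x ≈ y [ m ] → y ≈ x [ m ]
  ≈-sym {x} {y} {m} (congruent {q} int eq) = congruent (integral-neg int)
    (trans (solve 3 (λ y m q → y := y :+ m :* q :+ m :* :- q) refl y m q) (cong (_+ m * - q) (sym eq)))

  ≈-trans : ∀ {x y z m} → x ≈ y [ m ] → y ≈ z [ m ] → x ≈ z [ m ]
  ≈-trans {z = z} {m} (congruent {q} int eq) (congruent {q′} int′ eq′) = congruent (integral-+ int′ int)
    (trans eq (trans (cong (_+ m * q) eq′)
      (solve 4 (λ z m q q′ → z :+ m :* q′ :+ m :* q := z :+ m :* (q′ :+ q)) refl z m q q′)))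

  +-cong-≈ : ∀ {x y z w m} → x ≈ y [ m ] → z ≈ w [ m ] → x + z ≈ y + w [ m ]
  +-cong-≈ {y = y} {w = w} {m} (congruent {q} int eq) (congruent {q′} int′ eq′) = congruent (integral-+ int int′)
    (trans (cong₂ _+_ eq eq′)
      (solve 5 (λ y w m q q′ → y :+ m :* q :+ (w :+ m :* q′) := y :+ w :+ m :* (q :+ q′)) refl y w m q q′))

  +-congˡ-≈ : ∀ z {x y m} → x ≈ y [ m ] → z + x ≈ z + y [ m ]
  +-congˡ-≈ z = +-cong-≈ (≈-refl {z})

  +-congʳ-≈ : ∀ z {x y m} → x ≈ y [ m ] → x + z ≈ y + z [ m ]
  +-congʳ-≈ z x≈y = +-cong-≈ x≈y (≈-refl {z})

  -- Multiplying by p lifts a congruence modulo p to one modulo p²; `cancel-≈` goes back.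
  scale-≈ : ∀ c {x y m} → x ≈ y [ m ] → c * x ≈ c * y [ c * m ]
  scale-≈ c {y = y} {m} (congruent {q} int eq) = congruent int
    (trans (cong (c *_) eq) (solve 4 (λ c y m q → c :* (y :+ m :* q) := c :* y :+ c :* m :* q) refl c y m q))

  cancel-≈ : ∀ n {x y m} → fromℕ (suc n) * x ≈ fromℕ (suc n) * y [ fromℕ (suc n) * m ] → x ≈ y [ m ]
  cancel-≈ n {x} {y} {m} (congruent {q} int eq) = congruent int (fromℕ*-cancelˡ n
    (trans eq (solve 4 (λ c y m q → c :* y :+ c :* m :* q := c :* (y :+ m :* q)) refl (fromℕ (suc n)) y m q)))

  *-congˡ-≈ : ∀ {c x y m} → Integral c → x ≈ y [ m ] → c * x ≈ c * y [ m ]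
  *-congˡ-≈ {c} {y = y} {m} int-c (congruent {q} int eq) = congruent (integral-* int-c int)
    (trans (cong (c *_) eq) (solve 4 (λ c y m q → c :* (y :+ m :* q) := c :* y :+ m :* (c :* q)) refl c y m q))

  *-congʳ-≈ : ∀ {c x y m} → Integral c → x ≈ y [ m ] → x * c ≈ y * c [ m ]
  *-congʳ-≈ {c} {x} {y} {m} int-c x≈y =
    ≈-trans (≡⇒≈ (*-comm x c)) (≈-trans (*-congˡ-≈ int-c x≈y) (≡⇒≈ (*-comm c y)))

  neg-cong-≈ : ∀ {x y m} → x ≈ y [ m ] → - x ≈ - y [ m ]
  neg-cong-≈ {y = y} {m} (congruent {q} int eq) = congruent (integral-neg int)
    (trans (cong -_ eq) (solve 3 (λ y m q → :- (y :+ m :* q) := :- y :+ m :* :- q) refl y m q))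

  multiple-≈0 : ∀ {m q} → Integral q → m * q ≈ 0ℚ [ m ]
  multiple-≈0 {m} {q} int = congruent int (sym (+-identityˡ (m * q)))

  ∑-cong-≈ : ∀ n {f g m} → (∀ i → i < n → f i ≈ g i [ m ]) → ∑ n f ≈ ∑ n g [ m ]
  ∑-cong-≈ zero    eq = ≈-refl
  ∑-cong-≈ (suc n) eq = +-cong-≈ (∑-cong-≈ n (λ i i<n → eq i (ℕ.m<n⇒m<1+n i<n))) (eq n ℕ.≤-refl)

  ∣⇒≈0 : ∀ {m a} → m ∣ a → fromℕ a ≈ 0ℚ [ fromℕ m ]
  ∣⇒≈0 {m} (divides q refl) = subst (_≈ 0ℚ [ fromℕ m ])
    (trans (*-comm (fromℕ m) (fromℕ q)) (sym (fromℕ-homo-* q m))) (multiple-≈0 (integral-fromℕ q))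

  -- Clearing the denominator e of the quotient gives a e = b p, and p does not divide e.
  ι-≈0⇒∣ : ∀ {a} → ι a ≈ 0ℚ [ fromℕ p ] → p ∣ ℤ.∣ a ∣
  ι-≈0⇒∣ {a} (congruent {q} (integral e b p∤e qe≡b) a≡pq) =
    Sum.[ id , (λ p∣e → contradiction p∣e p∤e) ]′ (euclidsLemma ℤ.∣ a ∣ e p-prime p∣ae)
    where
    ae≡bp : ι (a ℤ.* ℤ.+ e) ≡ ι (b ℤ.* ℤ.+ p)
    ae≡bp = begin
      ι (a ℤ.* ℤ.+ e)               ≡⟨ ι-homo-* a (ℤ.+ e) ⟩
      ι a * fromℕ e                 ≡⟨ cong (_* fromℕ e) a≡pq ⟩
      (0ℚ + fromℕ p * q) * fromℕ e  ≡⟨ solve 3 (λ p q e → (con 0ℚ :+ p :* q) :* e := q :* e :* p) refl (fromℕ p) q (fromℕ e) ⟩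
      q * fromℕ e * fromℕ p         ≡⟨ cong (_* fromℕ p) qe≡b ⟩
      ι b * fromℕ p                 ≡⟨ ι-homo-* b (ℤ.+ p) ⟨
      ι (b ℤ.* ℤ.+ p)               ∎
    p∣ae : p ∣ ℤ.∣ a ∣ ℕ.* e
    p∣ae = subst (p ∣_) (ℤ.abs-* a (ℤ.+ e))
      (ℤ∣.∣⇒∣ᵤ (ℤ∣.divides b (ι-injective {a ℤ.* ℤ.+ e} {b ℤ.* ℤ.+ p} ae≡bp)))

  ≡0modℚ⇒≈0 : ∀ {r} → ≡0modℚ p r → r ≈ 0ℚ [ fromℕ p ]
  ≡0modℚ⇒≈0 {r@(mkℚ n d-1 _)} (p∣n , p∤d) with ℤ∣.∣ᵤ⇒∣ {ℤ.+ p} {n} p∣n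
  ... | ℤ∣.divides z n≡zp = congruent (integral-* (integral-ι z) (integral-invℕ (suc d-1) p∤d)) (begin
    r                          ≡⟨ *-identityʳ r ⟨
    r * 1ℚ                     ≡⟨ cong (r *_) (fromℕ*invℕ d-1) ⟨
    r * (u * v)                ≡⟨ *-assoc r u v ⟨
    r * u * v                  ≡⟨ cong (_* v) (trans (*-↧ r) (trans (cong ι n≡zp) (ι-homo-* z (ℤ.+ p)))) ⟩
    ι z * fromℕ p * v          ≡⟨ solve 3 (λ z p v → z :* p :* v := con 0ℚ :+ p :* (z :* v)) refl (ι z) (fromℕ p) v ⟩
    0ℚ + fromℕ p * (ι z * v)   ∎)
    where
    u v : ℚ
    u = fromℕ (suc d-1)
    v = invℕ (suc d-1)

  ≈0⇒≡0modℚ : ∀ {r} → r ≈ 0ℚ [ fromℕ p ] → ≡0modℚ p r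
  ≈0⇒≡0modℚ {r@(mkℚ n d-1 coprime)} r≈0 = p∣n , λ p∣d →
    -- The fraction is reduced and `p` divides its numerator, so `p` in the denominator would be a
    -- common factor.
    ∤1 (subst (p ∣_) (Coprimality.recompute coprime (p∣n , p∣d)) (divides 1 (sym (ℕ.*-identityˡ p))))
    where
    p∣n : p ∣ ℤ.∣ n ∣
    p∣n = ι-≈0⇒∣ {n} (≈-trans (≡⇒≈ (sym (*-↧ r)))
      (≈-trans (*-congʳ-≈ (integral-fromℕ (suc d-1)) r≈0) (≡⇒≈ (*-zeroˡ (fromℕ (suc d-1))))))

-- Congruences for an odd prime

module OddPrime (r : ℕ) (p-prime : Prime (3 ℕ.+ r)) where

  open Local (3 ℕ.+ r) p-prime

  -- `m` is p - 2, the number of terms of Σ, and `n` is p - 1, the exponent in the root equation.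
  m n p : ℕ
  m = suc r
  n = suc m
  p = suc n

  P W : ℚ
  P = fromℕ p
  W = fromℕ (n !)

  infixr 2 _≈⟨_⟩_ _≡⟨_⟩≈_ _≡⟨_⟨≈_
  infix  3 _≈∎

  _≈⟨_⟩_ : ∀ x {y z c} → x ≈ y [ c ] → y ≈ z [ c ] → x ≈ z [ c ]
  _ ≈⟨ x≈y ⟩ y≈z = ≈-trans x≈y y≈z

  _≡⟨_⟩≈_ : ∀ x {y z c} → x ≡ y → y ≈ z [ c ] → x ≈ z [ c ]
  _ ≡⟨ x≡y ⟩≈ y≈z = ≈-trans (≡⇒≈ x≡y) y≈z

  _≡⟨_⟨≈_ : ∀ x {y z c} → y ≡ x → y ≈ z [ c ] → x ≈ z [ c ]
  _ ≡⟨ y≡x ⟨≈ y≈z = ≈-trans (≡⇒≈ (sym y≡x)) y≈z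

  _≈∎ : ∀ x {c} → x ≈ x [ c ]
  _ ≈∎ = ≈-refl

  integral-P : Integral P
  integral-P = integral-fromℕ p

  neg-^-n : ∀ x → (- x) ^ n ≡ x ^ n
  neg-^-n x with even-or-odd n
  ... | inj₁ (divides h n≡h*2) = subst (λ l → (- x) ^ l ≡ x ^ l) (sym n≡h*2) (neg-^-even x h)
  -- Here p would be even, so that 2 = 1 or 2 = p, both impossible.
  ... | inj₂ 2∣p with prime⇒irreducible p-prime 2∣p
  ...   | inj₁ ()
  ...   | inj₂ ()

  integral-β : ∀ j → j < n → Integral (β n j)
  integral-β j j<n = integral-* (integral-fromℕ (n C j)) (integral-invℕ (suc j) (∤-< (s<s j<n)))

  fermat : ∀ a → fromℕ a ^ p ≈ fromℕ a [ P ]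
  fermat zero    = ≡⇒≈ (*-zeroˡ (0ℚ ^ n))
  fermat (suc a) =
    fromℕ (suc a) ^ p
      ≡⟨ cong (_^ p) (trans (fromℕ-suc a) (+-comm 1ℚ A)) ⟩≈
    (A + 1ℚ) ^ p
      -- `T 1ℚ (A ^_) p` is the binomial expansion of (A + 1)^p, and `T-β` displays its middle part
      -- as a multiple of p.
      ≡⟨ trans (sym (T-^ 1ℚ A p)) (T-β 1ℚ (A ^_) n) ⟩≈
    A ^ p + P * ∑ n middle + 1ℚ * 1ℚ ^ p
      ≈⟨ +-cong-≈ (+-cong-≈ (fermat a) (multiple-≈0 (integral-∑ n integral-middle)))
           (≡⇒≈ (trans (*-identityˡ (1ℚ ^ p)) (1^n≡1 p))) ⟩
    A + 0ℚ + 1ℚ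
      ≡⟨ trans (cong (_+ 1ℚ) (+-identityʳ A)) (trans (+-comm A 1ℚ) (sym (fromℕ-suc a))) ⟩≈
    fromℕ (suc a) ≈∎
    where
    A : ℚ
    A = fromℕ a
    middle : ℕ → ℚ
    middle j = β n j * (A ^ suc j * 1ℚ ^ (n ∸ j))
    integral-middle : ∀ j → j < n → Integral (middle j)
    integral-middle j j<n = integral-* (integral-β j j<n)
      (integral-* (integral-^ (integral-fromℕ a) (suc j)) (integral-^ (integral-fromℕ 1) (n ∸ j)))

  fermat-unit : ∀ a → suc a < p → fromℕ (suc a) ^ n ≈ 1ℚ [ P ]
  fermat-unit a a<p =
    A ^ n               ≡⟨ inverse (A ^ n) ⟩≈
    v * (A * A ^ n)     ≈⟨ *-congˡ-≈ (integral-invℕ (suc a) (∤-< a<p)) (fermat (suc a)) ⟩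
    v * A               ≡⟨ trans (*-comm v A) (fromℕ*invℕ a) ⟩≈
    1ℚ                  ≈∎
    where
    A v : ℚ
    A = fromℕ (suc a)
    v = invℕ (suc a)
    inverse : ∀ x → x ≡ v * (A * x)
    inverse x = trans (sym (*-identityˡ x)) (trans (cong (_* x) (sym (fromℕ*invℕ a)))
      (solve 3 (λ A v x → A :* v :* x := v :* (A :* x)) refl A v x))

  -- Consecutive C(p-1, j) add up to C(p, j + 1) ≡ 0, so they alternate in sign. As p - 1 is even,
  -- (-1)^(p-1-j) equals (-1)^j; the first form is the one that a power of -k produces.
  Cℚ-signs : ∀ j → j < p → n Cℚ j * (- 1ℚ) ^ (n ∸ j) ≈ 1ℚ [ P ]
  Cℚ-signs zero    _       = ≡⇒≈ (trans (*-identityˡ _) (trans (neg-^-n 1ℚ) (1^n≡1 n)))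
  Cℚ-signs (suc j) 1+j<p@(s<s j<n) =
    n Cℚ suc j * e
      ≡⟨ solve 3 (λ c d e → d :* e := (c :+ d) :* e :+ c :* (:- con 1ℚ :* e)) refl (n Cℚ j) (n Cℚ suc j) e ⟩≈
    (n Cℚ j + n Cℚ suc j) * e + n Cℚ j * (- 1ℚ * e)
      ≡⟨ cong₂ (λ u s → u * e + n Cℚ j * s) (trans (sym (pascal n j)) (Cℚ-suc-suc n j))
           (cong ((- 1ℚ) ^_) (sym (ℕ.+-∸-assoc 1 j<n))) ⟩≈
    P * β n j * e + n Cℚ j * (- 1ℚ) ^ (n ∸ j)
      ≈⟨ +-cong-≈ (≈-trans (≡⇒≈ (*-assoc P (β n j) e)) (multiple-≈0 (integral-* (integral-β j j<n) integral-e)))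
           (Cℚ-signs j (ℕ.<-trans (ℕ.n<1+n j) 1+j<p)) ⟩
    0ℚ + 1ℚ
      ≡⟨ refl ⟩≈
    1ℚ ≈∎
    where
    e : ℚ
    e = (- 1ℚ) ^ (n ∸ suc j)
    integral-e : Integral e
    integral-e = integral-^ (integral-neg (integral-fromℕ 1)) (n ∸ suc j)

  -- For i ≥ 1, B_i arises by division by i + 1, which is prime to p while i ≤ p - 2. The recurrence
  -- uses all earlier values, hence the induction on a bound `l`.
  integral-bernoulli : ∀ l → l < p → ∀ i → i < l → Integral (bernoulli i)
  integral-bernoulli (suc l) 1+l<p i i<1+l with ℕ.m≤n⇒m<n∨m≡n (ℕ.s≤s⁻¹ i<1+l)
  ... | inj₁ i<l = integral-bernoulli l (ℕ.<-trans (ℕ.n<1+n l) 1+l<p) i i<l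
  integral-bernoulli (suc zero)    _     i i<1+l | inj₂ refl = integral-fromℕ 1
  integral-bernoulli (suc (suc l)) 2+l<p i i<1+l | inj₂ refl = subst Integral (sym (bernoulli-suc l))
    (integral-neg (integral-* (integral-invℕ (suc (suc l)) (∤-< 2+l<p))
      (integral-∑ (suc l) (λ j j<1+l → integral-* (integral-fromℕ (suc (suc l) C j))
        (integral-bernoulli (suc l) (ℕ.<-trans (ℕ.n<1+n (suc l)) 2+l<p) j j<1+l)))))

  integral-bernoulli-suc : ∀ j → j < m → Integral (bernoulli (suc j))
  integral-bernoulli-suc j j<m = integral-bernoulli n ℕ.≤-refl (suc j) (s<s j<m)

  -- The sum of the powers j^(p-1) modulo p²

  -- Evaluating the Bernoulli polynomial of degree p at p.
  power-sum≈p*bernoulli : ∑ n (λ j → fromℕ (suc j) ^ n) ≈ P * bernoulli n [ P * P ]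
  power-sum≈p*bernoulli =
    S
      ≡⟨ fromℕ*-cancelˡ n P*S≡ ⟩≈
    Y + bernoulli n * P + P ^ n
      ≈⟨ +-cong-≈ (+-cong-≈ Y≈0 (≡⇒≈ (*-comm (bernoulli n) P))) P^n≈0 ⟩
    0ℚ + P * bernoulli n + 0ℚ
      ≡⟨ trans (+-identityʳ _) (+-identityˡ _) ⟩≈
    P * bernoulli n ≈∎
    where
    S Y : ℚ
    S = ∑ n (λ j → fromℕ (suc j) ^ n)
    Y = ∑ m (λ j → β n j * (bernoulli (suc j) * P ^ (n ∸ j)))
    -- For j < p - 2 the exponent n - j is at least 2, so p² divides the power; p ≥ 3 gives the same
    -- for `P ^ n`.
    square-≈0 : ∀ {c} e → Integral c → c * P ^ suc (suc e) ≈ 0ℚ [ P * P ]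
    square-≈0 {c} e int-c = ≈-trans
      (≡⇒≈ (solve 3 (λ c p x → c :* (p :* (p :* x)) := p :* p :* (c :* x)) refl c P (P ^ e)))
      (multiple-≈0 (integral-* int-c (integral-^ integral-P e)))
    P^n≈0 : P ^ n ≈ 0ℚ [ P * P ]
    P^n≈0 = ≈-trans (≡⇒≈ (sym (*-identityˡ (P ^ n)))) (square-≈0 r (integral-fromℕ 1))
    Y≈0 : Y ≈ 0ℚ [ P * P ]
    Y≈0 = ≈-trans (∑-cong-≈ m term≈0) (≡⇒≈ (trans (∑-const m 0ℚ) (*-zeroʳ (fromℕ m))))
      where
      term≈0 : ∀ j → j < m → β n j * (bernoulli (suc j) * P ^ (n ∸ j)) ≈ 0ℚ [ P * P ]
      term≈0 j j<m@(s<s j≤r) = ≈-trans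
        (≡⇒≈ (trans (sym (*-assoc (β n j) (bernoulli (suc j)) _))
          (cong (λ e → β n j * bernoulli (suc j) * P ^ e) (ℕ.+-∸-assoc 2 {r} {j} j≤r))))
        (square-≈0 (r ∸ j) (integral-* (integral-β j (ℕ.m<n⇒m<1+n j<m)) (integral-bernoulli-suc j j<m)))
    -- Two expressions for B_p(p) are compared: B_p cancels, 0^(p-1) vanishes, and a common factor p
    -- is left to divide out.
    P*S≡ : P * S ≡ P * (Y + bernoulli n * P + P ^ n)
    P*S≡ = begin
      P * S
        ≡⟨ cong (P *_) (trans (sym (+-identityˡ S)) (cong (_+ S) (sym (*-zeroˡ (0ℚ ^ m))))) ⟩
      P * (0ℚ ^ n + S)
        ≡⟨ cong (P *_) (∑-head n (λ j → fromℕ j ^ n)) ⟨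
      P * ∑ p (λ j → fromℕ j ^ n)
        ≡⟨ solve 2 (λ b u → u := :- b :+ (b :+ u)) refl (bernoulli p) _ ⟩
      - bernoulli p + (bernoulli p + P * ∑ p (λ j → fromℕ j ^ n))
        ≡⟨ cong (λ z → - bernoulli p + z) (trans (sym (T-bernoulli-fromℕ n p)) (T-bernoulli-β P m)) ⟩
      - bernoulli p + (bernoulli p + P * (Y + bernoulli n * P) + P * P ^ n)
        ≡⟨ solve 4 (λ b p y x → :- b :+ (b :+ p :* y :+ p :* x) := p :* (y :+ x)) refl (bernoulli p) P (Y + bernoulli n * P) (P ^ n) ⟩
      P * (Y + bernoulli n * P + P ^ n) ∎

  -- (1 + p u)(1 + p v) ≡ 1 + p u + p v modulo p². The congruence modulo p is carried along because
  -- the induction step needs the partial product in the form 1 + p u.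
  ∏-one-units : ∀ l f → (∀ j → j < l → f j ≈ 1ℚ [ P ]) →
    ∏ l f ≈ 1ℚ [ P ] × ∏ l f ≈ 1ℚ + ∑ l (λ j → f j - 1ℚ) [ P * P ]
  ∏-one-units zero    f f≈1 = ≈-refl , ≈-refl
  ∏-one-units (suc l) f f≈1 with ∏-one-units l f (λ j j<l → f≈1 j (ℕ.m<n⇒m<1+n j<l)) | f≈1 l ℕ.≤-refl
  ... | congruent {q} int-q A≡ , A≈ | congruent {q′} int-q′ B≡ = first , second
    where
    A B s : ℚ
    A = ∏ l f
    B = f l
    s = ∑ l (λ j → f j - 1ℚ)
    first : A * B ≈ 1ℚ [ P ]
    first = congruent (integral-+ (integral-+ int-q int-q′) (integral-* integral-P (integral-* int-q int-q′)))
      (trans (cong₂ _*_ A≡ B≡)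
        (solve 3 (λ p q q′ → (con 1ℚ :+ p :* q) :* (con 1ℚ :+ p :* q′) := con 1ℚ :+ p :* (q :+ q′ :+ p :* (q :* q′))) refl P q q′))
    A*B≈A+B-1 : A * B ≈ A + (B - 1ℚ) [ P * P ]
    A*B≈A+B-1 = congruent (integral-* int-q int-q′) (trans (cong₂ _*_ A≡ B≡) (trans
      (solve 3 (λ p q q′ → (con 1ℚ :+ p :* q) :* (con 1ℚ :+ p :* q′)
        := con 1ℚ :+ p :* q :+ (con 1ℚ :+ p :* q′ :- con 1ℚ) :+ p :* p :* (q :* q′)) refl P q q′)
      (sym (cong₂ (λ u v → u + (v - 1ℚ) + P * P * (q * q′)) A≡ B≡))))
    second : A * B ≈ 1ℚ + (s + (B - 1ℚ)) [ P * P ]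
    second = ≈-trans A*B≈A+B-1 (≈-trans (+-congʳ-≈ (B - 1ℚ) A≈) (≡⇒≈ (+-assoc 1ℚ s (B - 1ℚ))))

  ∏-! : ∀ l → ∏ l (λ j → fromℕ (suc j) ^ n) ≡ fromℕ (l !) ^ n
  ∏-! zero    = sym (1^n≡1 n)
  ∏-! (suc l) = begin
    ∏ l (λ j → fromℕ (suc j) ^ n) * fromℕ (suc l) ^ n  ≡⟨ cong (_* fromℕ (suc l) ^ n) (∏-! l) ⟩
    fromℕ (l !) ^ n * fromℕ (suc l) ^ n                ≡⟨ *-comm (fromℕ (l !) ^ n) _ ⟩
    fromℕ (suc l) ^ n * fromℕ (l !) ^ n                ≡⟨ ^-distrib-* (fromℕ (suc l)) (fromℕ (l !)) n ⟨
    (fromℕ (suc l) * fromℕ (l !)) ^ n                  ≡⟨ cong (_^ n) (fromℕ-homo-* (suc l) (l !)) ⟨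
    fromℕ (suc l !) ^ n                                ∎

  -- W ^ n is the product of all j ^ n and also of n factors - W; both are products of
  -- numbers ≡ 1 (mod p), which are linear modulo p².
  power-sum≈W+P : - W ≈ 1ℚ [ P ] → ∑ n (λ j → fromℕ (suc j) ^ n) ≈ W + P [ P * P ]
  power-sum≈W+P -W≈1@(congruent {q} int-q -W≡) =
    S
      ≡⟨ solve 2 (λ s t → s := con 1ℚ :+ t :+ (s :- con 1ℚ :- t)) refl S (∑ n (λ j → fromℕ (suc j) ^ n - 1ℚ)) ⟩≈
    1ℚ + ∑ n (λ j → fromℕ (suc j) ^ n - 1ℚ) + (S - 1ℚ - ∑ n (λ j → fromℕ (suc j) ^ n - 1ℚ))
      ≈⟨ +-cong-≈ linear (≡⇒≈ (cong (λ z → S - 1ℚ - z) ∑-shift)) ⟩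
    1ℚ + fromℕ n * (- W - 1ℚ) + (S - 1ℚ - (S - fromℕ n))
      ≡⟨ solve 3 (λ w s n → con 1ℚ :+ n :* (:- w :- con 1ℚ) :+ (s :- con 1ℚ :- (s :- n))
           := (con 1ℚ :+ n) :* (:- w :- con 1ℚ) :+ (w :+ (con 1ℚ :+ n))) refl W S (fromℕ n) ⟩≈
    (1ℚ + fromℕ n) * (- W - 1ℚ) + (W + (1ℚ + fromℕ n))
      ≡⟨ cong (λ z → z * (- W - 1ℚ) + (W + z)) (sym (fromℕ-suc n)) ⟩≈
    P * (- W - 1ℚ) + (W + P)
      ≈⟨ +-congʳ-≈ (W + P) small ⟩
    0ℚ + (W + P)
      ≡⟨ +-identityˡ (W + P) ⟩≈
    W + P ≈∎
    where
    S : ℚ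
    S = ∑ n (λ j → fromℕ (suc j) ^ n)
    ∑-shift : ∑ n (λ j → fromℕ (suc j) ^ n - 1ℚ) ≡ S - fromℕ n
    ∑-shift = trans (∑-+ n (λ j → fromℕ (suc j) ^ n) (λ _ → - 1ℚ))
      (cong (S +_) (trans (∑-const n (- 1ℚ)) (solve 1 (λ n → n :* :- con 1ℚ := :- n) refl (fromℕ n))))
    linear : 1ℚ + ∑ n (λ j → fromℕ (suc j) ^ n - 1ℚ) ≈ 1ℚ + fromℕ n * (- W - 1ℚ) [ P * P ]
    linear = ≈-trans (≈-sym (proj₂ (∏-one-units n _ (λ j j<n → fermat-unit j (s<s j<n)))))
      -- `n` is even, so W^n is also (-W)^n, whose base is ≡ 1 modulo p.
      (≈-trans (≡⇒≈ (trans (∏-! n) (trans (sym (neg-^-n W)) (sym (∏-const n (- W))))))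
      (≈-trans (proj₂ (∏-one-units n (λ _ → - W) (λ _ _ → -W≈1)))
      (≡⇒≈ (cong (λ z → 1ℚ + z) (∑-const n (- W - 1ℚ))))))
    small : P * (- W - 1ℚ) ≈ 0ℚ [ P * P ]
    small = congruent int-q (trans (cong (λ z → P * (z - 1ℚ)) -W≡)
      (solve 2 (λ p q → p :* (con 1ℚ :+ p :* q :- con 1ℚ) := con 0ℚ :+ p :* p :* q) refl P q))

  -- The sum Σ for a fixed residue k

  module Residue (k-1 : ℕ) (k<p : suc k-1 < p) where

    k : ℕ
    k = suc k-1

    K Σk : ℚ
    K  = fromℕ k
    Σk = sumBern k m

    integral-K : Integral K
    integral-K = integral-fromℕ k

    p∤k : ¬ p ∣ k
    p∤k = ∤-< k<p

    K^n≈1 : K ^ n ≈ 1ℚ [ P ]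
    K^n≈1 = fermat-unit k-1 k<p

    σ : ℕ → ℚ
    σ j = bernoulli (suc j) * invℕ (suc j ℕ.* k ℕ.^ suc j)

    sumBern-∑ : ∀ l → sumBern k l ≡ ∑ l σ
    sumBern-∑ zero    = refl
    sumBern-∑ (suc l) = cong (_+ σ l) (sumBern-∑ l)

    ∤-^ : ∀ l → ¬ p ∣ k ℕ.^ l
    ∤-^ zero    = ∤1
    ∤-^ (suc l) = ∤-* p∤k (∤-^ l)

    integral-Σk : Integral Σk
    integral-Σk = subst Integral (sym (sumBern-∑ m)) (integral-∑ m (λ j j<m → integral-*
      (integral-bernoulli-suc j j<m)
      (integral-invℕ _ (∤-* (∤-< (s<s (ℕ.m<n⇒m<1+n j<m))) (∤-^ (suc j))))))

    K^p*σ : ∀ j → j < n → K ^ p * σ j ≡ bernoulli (suc j) * (K ^ (n ∸ j) * invℕ (suc j))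
    K^p*σ j j<n = begin
      K ^ p * (b * i)
        ≡⟨ cong (λ e → K ^ e * (b * i)) (ℕ.m+[n∸m]≡n (ℕ.m<n⇒m<1+n j<n)) ⟨
      K ^ (suc j ℕ.+ (n ∸ j)) * (b * i)
        ≡⟨ cong (_* (b * i)) (^-homo-* K (suc j) (n ∸ j)) ⟩
      K ^ suc j * K ^ (n ∸ j) * (b * i)
        ≡⟨ solve 4 (λ x y b i → x :* y :* (b :* i) := b :* (y :* (x :* i))) refl (K ^ suc j) (K ^ (n ∸ j)) b i ⟩
      b * (K ^ (n ∸ j) * (K ^ suc j * i))
        ≡⟨ cong (λ z → b * (K ^ (n ∸ j) * (z * i))) (fromℕ-homo-^ k (suc j)) ⟨
      b * (K ^ (n ∸ j) * (fromℕ (k ℕ.^ suc j) * i))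
        ≡⟨ cong (λ z → b * (K ^ (n ∸ j) * z)) (cancel-invℕ j (k ℕ.^ suc j) ⦃ ℕ.m^n≢0 k (suc j) ⦄) ⟩
      b * (K ^ (n ∸ j) * invℕ (suc j)) ∎
      where
      b i : ℚ
      b = bernoulli (suc j)
      i = invℕ (suc j ℕ.* k ℕ.^ suc j)

    -- Evaluating the Bernoulli polynomial of degree p at - k.
    P*K^p*Σk : P * (K ^ p * Σk) ≈ K ^ p + P * bernoulli n * K - P * K [ P * P ]
    P*K^p*Σk =
      P * (K ^ p * Σk)
        ≈⟨ scale-≈ P (≈-sym X≈) ⟩
      P * X
        -- The B_(p-1) term is split off and kept exact; only the power sum `S` is reduced modulo p.
        ≡⟨ solve 5 (λ p x b k y → p :* x := :- (b :* :- k :* p :- y) :+ (p :* (x :+ b :* :- k) :- y)) refl P X (bernoulli n) K (K ^ p) ⟩≈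
      - (bernoulli n * - K * P - K ^ p) + (P * (X + bernoulli n * - K) - K ^ p)
        ≡⟨ cong (λ z → - (bernoulli n * - K * P - K ^ p) + z) difference ⟩≈
      - (bernoulli n * - K * P - K ^ p) + - (P * S)
        ≈⟨ +-congˡ-≈ (- (bernoulli n * - K * P - K ^ p)) (neg-cong-≈ (scale-≈ P S≈K)) ⟩
      - (bernoulli n * - K * P - K ^ p) + - (P * K)
        ≡⟨ solve 4 (λ p b k y → :- (b :* :- k :* p :- y) :+ :- (p :* k) := y :+ p :* b :* k :- p :* k) refl P (bernoulli n) K (K ^ p) ⟩≈
      K ^ p + P * bernoulli n * K - P * K ≈∎
      where
      S X : ℚ
      S = ∑ k (λ j → fromℕ (suc j) ^ n)
      X = ∑ m (λ j → β n j * (bernoulli (suc j) * (- K) ^ (n ∸ j)))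
      S≈K : S ≈ K [ P ]
      S≈K = ≈-trans (∑-cong-≈ k (λ j j<k → fermat-unit j (ℕ.≤-<-trans j<k k<p)))
        (≡⇒≈ (trans (∑-const k 1ℚ) (*-identityʳ K)))
      difference : P * (X + bernoulli n * - K) - K ^ p ≡ - (P * S)
      difference = begin
        P * Z - K ^ p
          ≡⟨ solve 4 (λ b p z y → p :* z :- y := :- b :+ (b :+ p :* z :+ :- y)) refl (bernoulli p) P Z (K ^ p) ⟩
        - bernoulli p + (bernoulli p + P * Z + - (K ^ p))
          ≡⟨ cong (λ y → - bernoulli p + (bernoulli p + P * Z + y)) (trans (neg-distribˡ-* K (K ^ n)) (cong (- K *_) (sym (neg-^-n K)))) ⟩
        - bernoulli p + (bernoulli p + P * Z + (- K) ^ p)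
          ≡⟨ cong (λ z → - bernoulli p + z) (trans (sym (T-bernoulli-β (- K) m)) (T-bernoulli-neg n k neg-^-n)) ⟩
        - bernoulli p + (bernoulli p - P * S)
          ≡⟨ solve 2 (λ b s → :- b :+ (b :- s) := :- s) refl (bernoulli p) (P * S) ⟩
        - (P * S) ∎
        where
        Z : ℚ
        Z = X + bernoulli n * - K
      X≈ : X ≈ K ^ p * Σk [ P ]
      X≈ = ≈-trans (∑-cong-≈ m term) (≡⇒≈ (trans (∑-* m (K ^ p) σ) (cong (K ^ p *_) (sym (sumBern-∑ m)))))
        where
        term : ∀ j → j < m → β n j * (bernoulli (suc j) * (- K) ^ (n ∸ j)) ≈ K ^ p * σ j [ P ]
        term j j<m =
          c * i * (b * (- K) ^ (n ∸ j))
            -- Writing -K as (-1) K separates the sign, which then cancels against the binomial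
            -- coefficient.
            ≡⟨ cong (λ z → c * i * (b * z)) (trans (cong (_^ (n ∸ j)) (solve 1 (λ k → :- k := :- con 1ℚ :* k) refl K)) (^-distrib-* (- 1ℚ) K (n ∸ j))) ⟩≈
          c * i * (b * (e * x))
            ≡⟨ solve 5 (λ c i b e x → c :* i :* (b :* (e :* x)) := c :* e :* (b :* (x :* i))) refl c i b e x ⟩≈
          c * e * (b * (x * i))
            ≈⟨ *-congʳ-≈ (integral-* (integral-bernoulli-suc j j<m) (integral-* (integral-^ integral-K (n ∸ j))
                 (integral-invℕ (suc j) (∤-< (s<s j<n))))) (Cℚ-signs j (ℕ.m<n⇒m<1+n j<n)) ⟩
          1ℚ * (b * (x * i))
            ≡⟨ trans (*-identityˡ _) (sym (K^p*σ j j<n)) ⟩≈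
          K ^ p * σ j ≈∎
          where
          j<n : j < n
          j<n = ℕ.m<n⇒m<1+n j<m
          c i b e x : ℚ
          c = n Cℚ j
          i = invℕ (suc j)
          b = bernoulli (suc j)
          e = (- 1ℚ) ^ (n ∸ j)
          x = K ^ (n ∸ j)

    -- First-order expansion of the root

    module Root (a : ℕ) (root₁ : K ^ n + W ≈ 0ℚ [ P ])
      (root₂ : (K + fromℕ a * P) ^ n + W ≈ 0ℚ [ P * P ]) where

      A X : ℚ
      A = fromℕ a
      X = K + A * P

      integral-A : Integral A
      integral-A = integral-fromℕ a

      -- Wilson's congruence, read off from the root modulo p and Fermat.
      -W≈1 : - W ≈ 1ℚ [ P ]
      -W≈1 =
        - W                            ≡⟨ solve 2 (λ y w → :- w := y :+ :- (y :+ w)) refl (K ^ n) W ⟩≈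
        K ^ n + - (K ^ n + W)          ≈⟨ +-cong-≈ K^n≈1 (neg-cong-≈ root₁) ⟩
        1ℚ                             ≈∎

      -- The first-order expansion of X ^ l, multiplied by K to avoid the exponent l - 1.
      K*X^ : ∀ l → K * X ^ l ≈ K ^ l * (K + fromℕ l * A * P) [ P * P ]
      K*X^ zero    = ≡⇒≈ (solve 3 (λ k a p → k :* con 1ℚ := con 1ℚ :* (k :+ con 0ℚ :* a :* p)) refl K A P)
      K*X^ (suc l) =
        K * (X * X ^ l)
          ≡⟨ solve 3 (λ k x y → k :* (x :* y) := x :* (k :* y)) refl K X (X ^ l) ⟩≈
        X * (K * X ^ l)
          ≈⟨ *-congˡ-≈ (integral-+ integral-K (integral-* integral-A integral-P)) (K*X^ l) ⟩
        X * (K ^ l * (K + L * A * P))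
          ≈⟨ congruent (integral-* (integral-^ integral-K l) (integral-* (integral-fromℕ l) (integral-* integral-A integral-A)))
               (solve 5 (λ k a p y l → (k :+ a :* p) :* (y :* (k :+ l :* a :* p))
                 := k :* y :* (k :+ (con 1ℚ :+ l) :* a :* p) :+ p :* p :* (y :* (l :* (a :* a)))) refl K A P (K ^ l) L) ⟩
        K * K ^ l * (K + (1ℚ + L) * A * P)
          ≡⟨ cong (λ z → K * K ^ l * (K + z * A * P)) (sym (fromℕ-suc l)) ⟩≈
        K ^ suc l * (K + fromℕ (suc l) * A * P) ≈∎
        where
        L : ℚ
        L = fromℕ l

      -- Replacing K^n by X^n adds n A p K^n modulo p² and makes the left side vanish. Since n ≡ -1
      -- and K^n ≡ 1 modulo p, this increment is -A p.
      K*[K^n+W]≈P*A : K * (K ^ n + W) ≈ P * A [ P * P ]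
      K*[K^n+W]≈P*A =
        K * (K ^ n + W)
          ≡⟨ solve 5 (λ k y w l u → k :* (y :+ w) := y :* (k :+ l :* u) :+ k :* w :+ :- (y :* (l :* u))) refl K (K ^ n) W N (A * P) ⟩≈
        K ^ n * (K + N * (A * P)) + K * W + - (K ^ n * (N * (A * P)))
          ≡⟨ cong (λ z → K ^ n * (K + z) + K * W + - (K ^ n * (N * (A * P)))) (sym (*-assoc N A P)) ⟩≈
        K ^ n * (K + N * A * P) + K * W + - (K ^ n * (N * (A * P)))
          ≈⟨ +-congʳ-≈ (- (K ^ n * (N * (A * P)))) (+-congʳ-≈ (K * W) (≈-sym (K*X^ n))) ⟩
        K * X ^ n + K * W + - (K ^ n * (N * (A * P)))
          ≡⟨ solve 6 (λ k x w y l u → k :* x :+ k :* w :+ :- (y :* (l :* u)) := k :* (x :+ w) :+ u :* (:- (y :* l))) refl K (X ^ n) W (K ^ n) N (A * P) ⟩≈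
        K * (X ^ n + W) + A * P * - (K ^ n * N)
          ≡⟨ cong (λ z → K * (X ^ n + W) + z) (solve 3 (λ a p u → a :* p :* u := p :* (a :* u)) refl A P (- (K ^ n * N))) ⟩≈
        K * (X ^ n + W) + P * (A * - (K ^ n * N))
          ≈⟨ +-cong-≈ (*-congˡ-≈ integral-K root₂) (scale-≈ P (*-congˡ-≈ integral-A -K^n*N≈1)) ⟩
        K * 0ℚ + P * (A * 1ℚ)
          ≡⟨ solve 3 (λ k p a → k :* con 0ℚ :+ p :* (a :* con 1ℚ) := p :* a) refl K P A ⟩≈
        P * A ≈∎
        where
        N : ℚ
        N = fromℕ n
        -K^n*N≈1 : - (K ^ n * N) ≈ 1ℚ [ P ]
        -K^n*N≈1 =
          - (K ^ n * N)          ≈⟨ neg-cong-≈ (*-congʳ-≈ (integral-fromℕ n) K^n≈1) ⟩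
          - (1ℚ * N)             ≡⟨ solve 1 (λ l → :- (con 1ℚ :* l) := con 1ℚ :+ :- (con 1ℚ :+ l)) refl N ⟩≈
          1ℚ + - (1ℚ + N)        ≡⟨ cong (λ z → 1ℚ + - z) (trans (sym (fromℕ-suc n)) (sym (*-identityʳ P))) ⟩≈
          1ℚ + - (P * 1ℚ)        ≈⟨ +-congˡ-≈ 1ℚ (neg-cong-≈ (multiple-≈0 (integral-fromℕ 1))) ⟩
          1ℚ                     ≈∎

      -- Fermat turns K into K^p, so that the congruence modulo p² for p K^p Σ can be divided by p.
      K*Σk≈A : K * Σk ≈ A [ P ]
      K*Σk≈A = ≈-trans (*-congʳ-≈ integral-Σk (≈-sym (fermat k))) (cancel-≈ n P*K^p*Σk≈P*A)
        where
        P*K^p*Σk≈P*A : P * (K ^ p * Σk) ≈ P * A [ P * P ]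
        P*K^p*Σk≈P*A =
          P * (K ^ p * Σk)
            ≈⟨ P*K^p*Σk ⟩
          K ^ p + P * bernoulli n * K - P * K
            -- The `P` in `W + P` offsets `- (P * K)`, leaving K times the value of the root
            -- polynomial at k.
            ≈⟨ +-congʳ-≈ (- (P * K)) (+-congˡ-≈ (K ^ p) (*-congʳ-≈ integral-K
                 (≈-trans (≈-sym power-sum≈p*bernoulli) (power-sum≈W+P -W≈1)))) ⟩
          K ^ p + (W + P) * K - P * K
            ≡⟨ solve 4 (λ k y w p → k :* y :+ (w :+ p) :* k :- p :* k := k :* (y :+ w)) refl K (K ^ n) W P ⟩≈
          K * (K ^ n + W)
            ≈⟨ K*[K^n+W]≈P*A ⟩
          P * A ≈∎

      -- K is a unit modulo p, so Σ and A vanish together modulo p, and a digit below p divisible by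
      -- p is 0.
      Σk≈0⇔a≡0 : a < p → ≡0modℚ p Σk ⇔ a ≡ 0
      Σk≈0⇔a≡0 a<p = mk⇔ to from
        where
        to : ≡0modℚ p Σk → a ≡ 0
        to Σk≡0 = p∣⇒≡0 a a<p (ι-≈0⇒∣ {ℤ.+ a} (≈-trans (≈-sym K*Σk≈A)
          (≈-trans (*-congˡ-≈ integral-K (≡0modℚ⇒≈0 Σk≡0)) (≡⇒≈ (*-zeroʳ K)))))
          where
          p∣⇒≡0 : ∀ a → a < p → p ∣ a → a ≡ 0
          p∣⇒≡0 zero    _   _   = refl
          p∣⇒≡0 (suc a) a<p p∣a = contradiction p∣a (∤-< a<p)
        from : a ≡ 0 → ≡0modℚ p Σk
        from refl = ≈0⇒≡0modℚ (
          Σk                 ≡⟨ *-identityˡ Σk ⟨≈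
          1ℚ * Σk            ≡⟨ cong (_* Σk) (trans (*-comm (invℕ k) K) (fromℕ*invℕ k-1)) ⟨≈
          invℕ k * K * Σk    ≡⟨ *-assoc (invℕ k) K Σk ⟩≈
          invℕ k * (K * Σk)  ≈⟨ *-congˡ-≈ (integral-invℕ k p∤k) K*Σk≈A ⟩
          invℕ k * 0ℚ        ≡⟨ *-zeroʳ (invℕ k) ⟩≈
          0ℚ                 ≈∎)

-- From the digit stream to congruences for the root

theorem15 : (p : ℕ) → Prime p → p ≢ 2 → (k : ℕ) → 1 ≤ k → k ≤ p ∸ 1 →
    (x : ℤₚ p) → IsRoot p x → toℕ (x 0) ≡ k →
    (≡0modℚ p (Σpk p k) ⇔ toℕ (x 1) ≡ 0)
theorem15 0 p-prime = contradiction (prime⇒nonTrivial p-prime) λ ()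
theorem15 1 p-prime = contradiction (prime⇒nonTrivial p-prime) λ ()
theorem15 2 _ p≢2 = contradiction refl p≢2
theorem15 p@(suc (suc (suc r))) p-prime _ k@(suc k-1) _ k≤p-1 x root x₀≡k = Σk≈0⇔a≡0 (toℕ<n (x 1))
  where
  open Local p p-prime
  open OddPrime r p-prime using (n; P; W)

  fromℕ-root : ∀ y → fromℕ (y ℕ.^ n ℕ.+ n !) ≡ fromℕ y ^ n + W
  fromℕ-root y = trans (fromℕ-homo-+ (y ℕ.^ n) (n !)) (cong (_+ W) (fromℕ-homo-^ y n))

  root₁ : fromℕ k ^ n + W ≈ 0ℚ [ P ]
  root₁ = subst₂ _≈ 0ℚ [_]
    (trans (fromℕ-root (toℕ (x 0) ℕ.* 1)) (cong (λ y → fromℕ y ^ n + W) (trans (ℕ.*-identityʳ _) x₀≡k)))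
    (cong fromℕ (ℕ.*-identityʳ p))
    (∣⇒≈0 (root 1))

  root₂ : (fromℕ k + fromℕ (toℕ (x 1)) * P) ^ n + W ≈ 0ℚ [ P * P ]
  root₂ = subst₂ _≈ 0ℚ [_]
    (trans (fromℕ-root (trunc x 2)) (cong (λ y → y ^ n + W) (begin
      fromℕ (toℕ (x 0) ℕ.* 1 ℕ.+ toℕ (x 1) ℕ.* (p ℕ.* 1))
        ≡⟨ cong₂ (λ u v → fromℕ (u ℕ.+ toℕ (x 1) ℕ.* v)) (trans (ℕ.*-identityʳ _) x₀≡k) (ℕ.*-identityʳ p) ⟩
      fromℕ (k ℕ.+ toℕ (x 1) ℕ.* p)
        ≡⟨ fromℕ-homo-+ k (toℕ (x 1) ℕ.* p) ⟩
      fromℕ k + fromℕ (toℕ (x 1) ℕ.* p)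
        ≡⟨ cong (fromℕ k +_) (fromℕ-homo-* (toℕ (x 1)) p) ⟩
      fromℕ k + fromℕ (toℕ (x 1)) * P ∎)))
    (trans (cong fromℕ (cong (p ℕ.*_) (ℕ.*-identityʳ p))) (fromℕ-homo-* p p))
    (∣⇒≈0 (root 2))

  -- `s≤s k≤p-1` gives k < p, and `Σpk p k` reduces to `sumBern k m` because p ∸ 2 is `m`.
  open OddPrime.Residue.Root r p-prime k-1 (s≤s k≤p-1) (toℕ (x 1)) root₁ root₂
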